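{- Let $r, k \ge 2$ and $1\leq \ell \le k/2$. For all $n > 12 r^2(k-\ell)+\ell$, we have \[\hat{R}_r(P_{n}^{(k,\ell)}) \ge \frac{r}{k^2}\,R_{ \lfloor\frac{2r-2}{3}\rfloor}(P_{n}^{(k,\ell)}).\] Moreover, $\Omega_k(r^{2}n)=\hat{R}_r(P_{n}^{(k,\ell)})=O((r^2\log r) n)$, i.e. there are constants $c,C>0$ depending only on $k$ such that $c\,r^2n\le \hat{R}_r(P_{n}^{(k,\ell)})\le C\,(r^2\log r)\,n$ for all sufficiently large $r$ and $n$.
   Context: A $k$-graph is a $k$-uniform hypergraph. For hypergraphs $G,H$ and an integer $r\ge 1$, $G\to_r H$ means that every $r$-coloring of the edges of $G$ contains a monochromatic copy of $H$. For a $k$-graph $H$, $\hat R_r(H)$ is the minimum number of edges and $R_r(H)$ the minimum number of vertices of a $k$-graph $G$ with $G\to_r H$. For $1\le \ell\le k-1$ and $m\ge 1$, the $(k,\ell)$-path with $m$ edges is the $k$-graph with vertex set $\{v_1,\dots,v_{k+(m-1)(k-\ell)}\}$ and edges $\{v_{(i-1)(k-\ell)+1},\dots,v_{(i-1)(k-\ell)+k}\}$ for $i\in[m]$; $P_n^{(k,\ell)}$ denotes the $(k,\ell)$-path with $n$ vertices. -}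

module Defs where

open import Data.Nat using (ℕ; zero; suc; _+_; _*_; _∸_; _≤_; _<_; _≤ᵇ_; _<ᵇ_)
open import Data.Nat.Logarithm using (⌈log₂_⌉)
open import Data.Bool using (Bool; true; false; _∧_)
open import Data.Fin using (Fin; toℕ)
open import Data.Fin.Properties using (any?)
open import Data.Fin.Subset using (Subset; _∈_; ∣_∣)
open import Data.Fin.Subset.Properties using (_∈?_)
open import Data.List using (List; length; lookup; map; upTo)
open import Data.List.Relation.Unary.All using (All)
open import Data.List.Relation.Unary.Unique.Propositional using (Unique)
open import Data.Vec using (tabulate)
open import Data.Product using (Σ; _×_; ∃; ∃-syntax)
open import Relation.Nullary using (does; _×-dec_)
open import Relation.Binary.PropositionalEquality using (_≡_)
open import Data.Fin using (_≟_)
open import Function.Definitions using (Injective)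

record Hypergraph : Set where
  constructor hg
  field
    nv    : ℕ
    edges : List (Subset nv)
open Hypergraph public

IsKGraph : ℕ → Hypergraph → Set
IsKGraph k G = Unique (edges G) × All (λ e → ∣ e ∣ ≡ k) (edges G)

ne : Hypergraph → ℕ
ne G = length (edges G)

image : ∀ {a b} → (Fin a → Fin b) → Subset a → Subset b
image {a} φ S = tabulate (λ x → does (any? (λ v → (v ∈? S) ×-dec (φ v ≟ x))))

Colouring : ℕ → Hypergraph → Set
Colouring r G = Fin (ne G) → Fin r

MonoCopy : (r : ℕ) (G : Hypergraph) → Colouring r G → Hypergraph → Set
MonoCopy r G c H =
  Σ (Fin (nv H) → Fin (nv G)) λ φ → Injective _≡_ _≡_ φ ×
  Σ (Fin r) λ i → All (λ e → Σ (Fin (ne G)) λ f → (lookup (edges G) f ≡ image φ e) × (c f ≡ i)) (edges H)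

Arrows : Hypergraph → ℕ → Hypergraph → Set
Arrows G r H = (c : Colouring r G) → MonoCopy r G c H

IsRamseyNum : (k r : ℕ) → Hypergraph → ℕ → Set
IsRamseyNum k r H N =
  (Σ Hypergraph λ G → IsKGraph k G × Arrows G r H × nv G ≡ N) ×
  ((G : Hypergraph) → IsKGraph k G → Arrows G r H → N ≤ nv G)

IsSizeRamseyNum : (k r : ℕ) → Hypergraph → ℕ → Set
IsSizeRamseyNum k r H M =
  (Σ Hypergraph λ G → IsKGraph k G × Arrows G r H × ne G ≡ M) ×
  ((G : Hypergraph) → IsKGraph k G → Arrows G r H → M ≤ ne G)

pathV : ℕ → ℕ → ℕ → ℕ
pathV k ℓ m = k + (m ∸ 1) * (k ∸ ℓ)

path : ℕ → ℕ → ℕ → Hypergraph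
path k ℓ m = hg (pathV k ℓ m)
  (map (λ j → tabulate (λ v → (j * (k ∸ ℓ) ≤ᵇ toℕ v) ∧ (toℕ v <ᵇ j * (k ∸ ℓ) + k))) (upTo m))

{-# OPTIONS --safe #-}
module Submission where

-- Lower bound for e(G) when G →_r P, where P has m edges.  Move vertices of large degree into r
-- buckets, one per colour, and give an edge meeting a bucket the colour of that bucket.  If the
-- remaining degrees are below 2a/k + 1, a defective colouring (Lovász) of the remaining edges
-- with a colours lets each of them meet at most one other edge of its colour.  Since 2ℓ ≤ k, a
-- vertex lies on at most two edges of P, so a monochromatic P needs about m/4 vertices in the
-- bucket of a colour shared with the remainder, and about m/2 in any other bucket.  Hence, as long
-- as fewer than (2r − a)m/4 vertices have been moved, there is one of degree at least 2a/k + 1;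
-- summing over a yields k e(G) ≥ (3/4) r² m up to lower order terms.
--
-- Upper bounds come from blow-ups of graphs: vertices become ℓ-sets and each edge receives
-- k − 2ℓ private vertices.  Depth-first search on a colour class without a path of m edges keeps
-- at most m vertices on its stack, and explored vertices see only the stack.  Removing vertices
-- one by one bounds R_s(P) by about k s m, which is at most k² e(G)/r for s ≤ 2(r − 1)/3 by the
-- lower bound above.  Removing them in chunks of m covers a colour class by few sets of 2m vertices; in a
-- suitably sparse graph with O(r² log r · m) edges, found by derandomising a union bound, r such
-- classes cannot exhaust all edges.
--
-- The size-Ramsey number exists constructively because deleting isolated vertices leaves a
-- finite search.

open import Defs
open import Data.Bool using (_∧_; false; if_then_else_; true)
open import Data.Bool.Properties using (T-∧; T-≡) renaming (_≟_ to _≟ᵇ_)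
open import Data.Empty using (⊥; ⊥-elim)
open import Data.Fin using (Fin; _↑ʳ_; _↑ˡ_; _≟_; combine; finToFun; fromℕ<; funToFin; inject≤; punchIn; punchOut; remQuot; splitAt; suc; toℕ; zero)
open import Data.Fin.Properties using (all?; any?; combine-injective; finToFun-funToFin; fromℕ<-injective; fromℕ<-toℕ; inject≤-injective; punchIn-injective; punchIn-punchOut; punchOut-injective; remQuot-combine; splitAt-↑ʳ; splitAt-↑ˡ; toℕ-fromℕ<; toℕ-injective; toℕ-inject≤; toℕ<n; ↑ʳ-injective; ↑ˡ-injective)
open import Data.Fin.Subset using (Subset; _∈_; _∉_; _⊆_; ∣_∣)
open import Data.Fin.Subset.Properties using (_∈?_; anySubset?; ∣p∣≤n; ⊆-antisym)
import Data.List as List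
open import Data.List using (List; []; _++_; _∷_; allFin; cartesianProduct; deduplicate; filter; length; lookup; map)
open import Data.List.Membership.Propositional using () renaming (_∈_ to _∈ˡ_; _∉_ to _∉ˡ_)
open import Data.List.Membership.Propositional.Properties using (∈-allFin; ∈-cartesianProduct⁺; ∈-deduplicate⁺; ∈-filter⁺; ∈-lookup; ∈-map⁺; ∈-upTo⁺; ∈-∃++) renaming (∈-tabulate⁺ to ∈ˡ-tabulate⁺)
open import Data.List.Properties using (length-++; length-deduplicate; length-filter; length-map; length-tabulate)
open import Data.List.Relation.Binary.Permutation.Propositional using (_↭_; ↭-sym; ↭⇒↭ₛ)
open import Data.List.Relation.Binary.Permutation.Propositional.Properties using (shift; ↭-length; ∈-resp-↭)
open import Data.List.Relation.Binary.Permutation.Setoid.Properties using (Unique-resp-↭)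
open import Data.List.Relation.Unary.All as All using (All; []; _∷_)
open import Data.List.Relation.Unary.All.Properties as AllP using (All¬⇒¬Any; all-filter; applyUpTo⁺₁; applyUpTo⁻; ¬Any⇒All¬)
open import Data.List.Relation.Unary.AllPairs using ([]; _∷_)
import Data.List.Relation.Unary.Any as Any
open import Data.List.Relation.Unary.Any using (Any; here; index; there)
open import Data.List.Relation.Unary.Any.Properties using (++⁻; lookup-index) renaming (++⁺ʳ to ∈-++⁺ʳ; ++⁺ˡ to ∈-++⁺ˡ)
open import Data.List.Relation.Unary.Linked using (Linked; [-]; []; _∷_)
open import Data.List.Relation.Unary.Unique.DecPropositional.Properties using (deduplicate-!)
open import Data.List.Relation.Unary.Unique.Propositional using (Unique)
open import Data.List.Relation.Unary.Unique.Propositional.Properties using (allFin⁺)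
open import Data.Nat using (>-nonZero; NonZero; _%_; _*_; _+_; _/_; _<?_; _<_; _<ᵇ_; _^_; _∸_; _≤?_; _≤_; _≤ᵇ_; suc; s≤s; zero; z≤n; ℕ; ⌈_/2⌉; ⌊_/2⌋) renaming (_≟_ to _≟ℕ_)
open import Data.Nat.DivMod using (m%n<n; m/n*n≤m; m≡m%n+[m/n]*n)
open import Data.Nat.Induction using (<-wellFounded)
open import Data.Nat.Logarithm using (⌈log₂_⌉; ⌈log₂⌉-mono-≤)
open import Data.Nat.Logarithm.Core using (⌈log2⌉)
open import Data.Nat.Properties hiding (_≟_; _≤?_; _<?_)
open import Data.Nat.Tactic.RingSolver using (solve-∀)
open import Data.Product using (_,_; _×_; proj₁; proj₂; Σ; ∃; ∃₂)
open import Data.Sum using ([_,_]′; _⊎_; inj₁; inj₂)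
open import Data.Vec as Vec using ([]; _∷_; tabulate)
open import Data.Vec.Properties using ([]=⇒lookup; lookup⇒[]=; lookup∘tabulate; ≡-dec)
open import Function using (_∘_; id)
open import Function.Bundles using (Equivalence)
open import Function.Definitions using (Injective)
open import Induction.WellFounded using (Acc; acc)
open import Relation.Binary.Definitions using (tri<; tri>; tri≈)
open import Relation.Binary.PropositionalEquality using (_≡_; _≢_; cong; cong₂; refl; subst; subst₂; sym; trans)
open import Relation.Binary.PropositionalEquality.Properties using () renaming (setoid to ≡-setoid)
open import Relation.Nullary using (Dec; _×-dec_; _⊎-dec_; contradiction; does; no; recompute; yes; ¬?; ¬_)
open import Relation.Nullary.Decidable using (_→-dec_; dec-true; decidable-stable; map′)
import Algebra.Properties.Semiring.Sum +-*-semiring as Sum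

-- Finite sums and counting

-- Sealed, so that unification compares summands instead of unfolding the monoid bundle.
opaque
  sum : ∀ {n} → (Fin n → ℕ) → ℕ
  sum = Sum.sum

  sum-zero : (f : Fin 0 → ℕ) → sum f ≡ 0
  sum-zero f = refl

  sum-suc : ∀ {n} (f : Fin (suc n) → ℕ) → sum f ≡ f zero + sum (f ∘ suc)
  sum-suc f = refl

  sum-cong : ∀ {n} {f g : Fin n → ℕ} → (∀ i → f i ≡ g i) → sum f ≡ sum g
  sum-cong = Sum.sum-cong-≗

  ∑-distrib-+ : ∀ {n} (f g : Fin n → ℕ) → sum (λ i → f i + g i) ≡ sum f + sum g
  ∑-distrib-+ = Sum.∑-distrib-+

  ∑-comm : ∀ {a b} (f : Fin a → Fin b → ℕ) → sum (λ i → sum (f i)) ≡ sum (λ j → sum (λ i → f i j))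
  ∑-comm = Sum.∑-comm

  *-distribˡ-sum : ∀ {n} c (f : Fin n → ℕ) → c * sum f ≡ sum (λ i → c * f i)
  *-distribˡ-sum = Sum.*-distribˡ-sum

  *-distribʳ-sum : ∀ {n} c (f : Fin n → ℕ) → sum f * c ≡ sum (λ i → f i * c)
  *-distribʳ-sum = Sum.*-distribʳ-sum

  sum-const : ∀ n c → sum {n} (λ _ → c) ≡ n * c
  sum-const zero c = refl
  sum-const (suc n) c = cong (c +_) (sum-const n c)

  sum-mono : ∀ {n} {f g : Fin n → ℕ} → (∀ i → f i ≤ g i) → sum f ≤ sum g
  sum-mono {zero} h = z≤n
  sum-mono {suc n} h = +-mono-≤ (h zero) (sum-mono (h ∘ suc))

  sum-remove : ∀ {n} (f : Fin (suc n) → ℕ) i → sum f ≡ f i + sum (f ∘ punchIn i)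
  sum-remove f i = Sum.sum-remove {i = i} f

  term≤sum : ∀ {n} (f : Fin n → ℕ) i → f i ≤ sum f
  term≤sum f zero = m≤m+n _ _
  term≤sum f (suc i) = ≤-trans (term≤sum (f ∘ suc) i) (m≤n+m _ _)

sum-bound : ∀ {n c} {f : Fin n → ℕ} → (∀ i → f i ≤ c) → sum f ≤ n * c
sum-bound {n} {c} h = ≤-trans (sum-mono h) (≤-reflexive (sum-const n c))

[_] : ∀ {a} {P : Set a} → Dec P → ℕ
[ P? ] = if does P? then 1 else 0

[]-mono : ∀ {a b} {P : Set a} {Q : Set b} (P? : Dec P) (Q? : Dec Q) → (P → Q) → [ P? ] ≤ [ Q? ]
[]-mono (no _) Q? h = z≤n
[]-mono (yes p) (yes q) h = ≤-refl
[]-mono (yes p) (no ¬q) h = ⊥-elim (¬q (h p))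

[]-cong : ∀ {a b} {P : Set a} {Q : Set b} (P? : Dec P) (Q? : Dec Q) → (P → Q) → (Q → P) → [ P? ] ≡ [ Q? ]
[]-cong P? Q? h h′ = ≤-antisym ([]-mono P? Q? h) ([]-mono Q? P? h′)

[]≤1 : ∀ {a} {P : Set a} (P? : Dec P) → [ P? ] ≤ 1
[]≤1 (yes _) = ≤-refl
[]≤1 (no _) = z≤n

[]-yes : ∀ {a} {P : Set a} (P? : Dec P) → P → [ P? ] ≡ 1
[]-yes (yes _) p = refl
[]-yes (no ¬p) p = ⊥-elim (¬p p)

[]-no : ∀ {a} {P : Set a} (P? : Dec P) → ¬ P → [ P? ] ≡ 0
[]-no (yes p) ¬p = ⊥-elim (¬p p)
[]-no (no _) _ = refl

[]-⊎ : ∀ {a b c} {P : Set a} {Q : Set b} {R : Set c} (P? : Dec P) (Q? : Dec Q) (R? : Dec R) →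
  (P → Q ⊎ R) → [ P? ] ≤ [ Q? ] + [ R? ]
[]-⊎ (no _) Q? R? h = z≤n
[]-⊎ (yes p) Q? R? h with h p
... | inj₁ q = ≤-trans (≤-reflexive (sym ([]-yes Q? q))) (m≤m+n _ _)
... | inj₂ r = ≤-trans (≤-reflexive (sym ([]-yes R? r))) (m≤n+m _ _)

# : ∀ {n} {P : Fin n → Set} → (∀ i → Dec (P i)) → ℕ
# P? = sum (λ i → [ P? i ])

module _ {n} {P Q : Fin n → Set} (P? : ∀ i → Dec (P i)) (Q? : ∀ i → Dec (Q i)) where
  #-mono : (∀ i → P i → Q i) → # P? ≤ # Q?
  #-mono h = sum-mono (λ i → []-mono (P? i) (Q? i) (h i))

  #-⊎ : {R : Fin n → Set} (R? : ∀ i → Dec (R i)) → (∀ i → P i → Q i ⊎ R i) → # P? ≤ # Q? + # R?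
  #-⊎ R? h = ≤-trans (sum-mono (λ i → []-⊎ (P? i) (Q? i) (R? i) (h i)))
                     (≤-reflexive (∑-distrib-+ (λ i → [ Q? i ]) (λ i → [ R? i ])))

  #-split : {R : Fin n → Set} (R? : ∀ i → Dec (R i)) →
    (∀ i → P i → Q i → ⊥) → (∀ i → P i ⊎ Q i → R i) → # P? + # Q? ≤ # R?
  #-split R? disj h = ≤-trans (≤-reflexive (sym (∑-distrib-+ (λ i → [ P? i ]) (λ i → [ Q? i ])))) (sum-mono go)
    where
    go : ∀ i → [ P? i ] + [ Q? i ] ≤ [ R? i ]
    go i with P? i | Q? i
    ... | yes p | yes q = ⊥-elim (disj i p q)
    ... | yes p | no _ = ≤-reflexive (sym ([]-yes (R? i) (h i (inj₁ p))))
    ... | no _ | yes q = ≤-reflexive (sym ([]-yes (R? i) (h i (inj₂ q))))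
    ... | no _ | no _ = z≤n

#-≟ : ∀ {n} (x : Fin n) → # (λ y → x ≟ y) ≡ 1
#-≟ {suc n} zero = trans (sum-suc _) (cong suc (trans (sum-const n 0) (*-zeroʳ n)))
#-≟ (suc x) = trans (sum-suc _) (trans (sum-cong (λ y → []-cong (suc x ≟ suc y) (x ≟ y) (λ { refl → refl }) (λ { refl → refl }))) (#-≟ x))

#-≟′ : ∀ {n} (x : Fin n) → # (λ y → y ≟ x) ≡ 1
#-≟′ x = trans (sum-cong (λ y → []-cong (y ≟ x) (x ≟ y) sym sym)) (#-≟ x)

#≤n : ∀ {n} {P : Fin n → Set} (P? : ∀ i → Dec (P i)) → # P? ≤ n
#≤n {n} P? = ≤-trans (sum-bound (λ i → []≤1 (P? i))) (≤-reflexive (*-identityʳ n))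

#-none : ∀ {n} {P : Fin n → Set} (P? : ∀ i → Dec (P i)) → (∀ i → ¬ P i) → # P? ≡ 0
#-none {n} P? h = trans (sum-cong (λ i → []-no (P? i) (h i))) (trans (sum-const n 0) (*-zeroʳ n))

#-pos : ∀ {n} {P : Fin n → Set} (P? : ∀ i → Dec (P i)) → 0 < # P? → ∃ P
#-pos P? h with any? P?
... | yes p = p
... | no ¬p = contradiction (#-none P? (λ i p → ¬p (i , p))) (n>0⇒n≢0 h)

_∈ˡ?_ : ∀ {n} (x : Fin n) (xs : List (Fin n)) → Dec (x ∈ˡ xs)
x ∈ˡ? xs = Any.any? (x ≟_) xs

#-∈ˡ : ∀ {n} (xs : List (Fin n)) → # (_∈ˡ? xs) ≤ length xs
#-∈ˡ {n} [] = ≤-reflexive (#-none {n} (_∈ˡ? []) (λ i ()))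
#-∈ˡ (x ∷ xs) = ≤-trans
  (#-⊎ (_∈ˡ? (x ∷ xs)) (_≟ x) (_∈ˡ? xs) (λ { i (here e) → inj₁ e ; i (there e) → inj₂ e }))
  (+-mono-≤ (≤-reflexive (#-≟′ x)) (#-∈ˡ xs))

#-fresh : ∀ {n} {P : Fin n → Set} (P? : ∀ i → Dec (P i)) (xs : List (Fin n)) →
  length xs < # P? → ∃ λ i → P i × i ∉ˡ xs
#-fresh P? xs h with any? (λ i → P? i ×-dec ¬? (i ∈ˡ? xs))
... | yes p = p
... | no ¬p = contradiction (≤-trans (#-mono P? (_∈ˡ? xs) g) (#-∈ˡ xs)) (<⇒≱ h)
  where
  g : ∀ i → _ → i ∈ˡ xs
  g i p with i ∈ˡ? xs
  ... | yes q = q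
  ... | no ¬q = ⊥-elim (¬p (i , p , ¬q))

sum-#-fibres : ∀ {n b} (f : Fin n → Fin b) → sum (λ y → # (λ i → f i ≟ y)) ≡ n
sum-#-fibres {n} f = trans (∑-comm (λ y i → [ f i ≟ y ]))
  (trans (sum-cong (λ i → #-≟ (f i))) (trans (sum-const n 1) (*-identityʳ n)))

pigeonhole-≤ : ∀ {n b c} (f : Fin n → Fin b) → (∀ y → # (λ i → f i ≟ y) ≤ c) → n ≤ b * c
pigeonhole-≤ f h = subst (_≤ _) (sum-#-fibres f) (sum-bound h)

rich-fibre : ∀ {n b c} (f : Fin n → Fin b) → b * c < n → ∃ λ y → c < # (λ i → f i ≟ y)
rich-fibre {c = c} f h with any? (λ y → c <? # (λ i → f i ≟ y))
... | yes p = p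
... | no ¬p = contradiction (pigeonhole-≤ f (λ y → ≮⇒≥ (λ q → ¬p (y , q)))) (<⇒≱ h)

∀⊎⇒ : ∀ {n} {P Q : Fin n → Set} → (∀ i → P i ⊎ Q i) → ∃ P ⊎ (∀ i → Q i)
∀⊎⇒ {zero} h = inj₂ λ ()
∀⊎⇒ {suc n} h with h zero | ∀⊎⇒ (h ∘ suc)
... | inj₁ p | _ = inj₁ (zero , p)
... | inj₂ _ | inj₁ (i , p) = inj₁ (suc i , p)
... | inj₂ q | inj₂ r = inj₂ λ { zero → q ; (suc i) → r i }

-- Depth-first search

module DFS {V : ℕ} (A : Fin V → Fin V → Set) (A? : ∀ u v → Dec (A u v))
           (A-sym : ∀ {u v} → A u v → A v u) (m : ℕ) where

  Path : Set
  Path = Σ (List (Fin V)) λ S → length S ≡ suc m × Unique S × Linked A S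

  -- `D`, `S` and `T` hold the explored vertices, the stack and the unvisited vertices. That `D` has
  -- no repetitions and is disjoint from the rest is implicit in `covered` and `size`.
  record State (D S T : List (Fin V)) : Set where
    field
      uniqueS : Unique S
      uniqueT : Unique T
      disjoint : ∀ {u} → u ∈ˡ S → u ∉ˡ T
      walk : Linked A S
      separated : ∀ {d t} → d ∈ˡ D → t ∈ˡ T → ¬ A d t
      covered : ∀ u → u ∈ˡ D ⊎ u ∈ˡ S ⊎ u ∈ˡ T
      size : length D + (length S + length T) ≡ V
  open State

  initial : State [] [] (allFin V)
  initial = record
    { uniqueS = [] ; uniqueT = allFin⁺ V ; disjoint = λ () ; walk = []
    ; separated = λ () ; covered = λ u → inj₂ (inj₂ (∈-allFin u)) ; size = length-tabulate id }

  reorder : ∀ {D S T T′} → T ↭ T′ → State D S T → State D S T′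
  reorder {D} {S} p st = record
    { uniqueS = uniqueS st
    ; uniqueT = Unique-resp-↭ (≡-setoid _) (↭⇒↭ₛ p) (uniqueT st)
    ; disjoint = λ a b → disjoint st a (∈-resp-↭ (↭-sym p) b)
    ; walk = walk st
    ; separated = λ a b → separated st a (∈-resp-↭ (↭-sym p) b)
    ; covered = λ u → [ inj₁ , (λ { (inj₁ a) → inj₂ (inj₁ a) ; (inj₂ b) → inj₂ (inj₂ (∈-resp-↭ p b)) }) ]′ (covered st u)
    ; size = trans (cong (λ z → length D + (length S + z)) (sym (↭-length p))) (size st) }

  push : ∀ {D S t T} → State D S (t ∷ T) → Linked A (t ∷ S) → State D (t ∷ S) T
  push {D} {S} {t} {T} st w with uniqueT st
  ... | t∉T ∷ uT = record
    { uniqueS = ¬Any⇒All¬ _ (λ a → disjoint st a (here refl)) ∷ uniqueS st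
    ; uniqueT = uT
    ; disjoint = λ { (here refl) b → All¬⇒¬Any t∉T b ; (there a) b → disjoint st a (there b) }
    ; walk = w
    ; separated = λ a b → separated st a (there b)
    ; covered = λ u → [ inj₁ , (λ { (inj₁ a) → inj₂ (inj₁ (there a)) ; (inj₂ (here e)) → inj₂ (inj₁ (here e)) ; (inj₂ (there b)) → inj₂ (inj₂ b) }) ]′ (covered st u)
    ; size = trans (cong (length D +_) (sym (+-suc (length S) (length T)))) (size st) }

  pop : ∀ {D s S T} → State D (s ∷ S) T → (∀ {t} → t ∈ˡ T → ¬ A s t) → State (s ∷ D) S T
  pop {D} {s} {S} {T} st h with uniqueS st
  ... | _ ∷ uS = record
    { uniqueS = uS
    ; uniqueT = uniqueT st
    ; disjoint = λ a b → disjoint st (there a) b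
    ; walk = tail (walk st)
    ; separated = λ { (here refl) b → h b ; (there a) b → separated st a b }
    ; covered = λ u → [ inj₁ ∘ there , (λ { (inj₁ (here e)) → inj₁ (here e) ; (inj₁ (there a)) → inj₂ (inj₁ a) ; (inj₂ b) → inj₂ (inj₂ b) }) ]′ (covered st u)
    ; size = trans (sym (+-suc (length D) _)) (size st) }
    where
    tail : ∀ {xs x} → Linked A (x ∷ xs) → Linked A xs
    tail [-] = []
    tail (_ ∷ w) = w

  private
    neighbour? : ∀ s T → (Σ (Fin V) λ t → A t s × t ∈ˡ T) ⊎ (∀ {t} → t ∈ˡ T → ¬ A s t)
    neighbour? s T with any? (λ t → A? t s ×-dec (t ∈ˡ? T))
    ... | yes p = inj₁ p
    ... | no ¬p = inj₂ λ b a → ¬p (_ , A-sym a , b)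

  Kill : List (Fin V) → Set
  Kill D = ∃ λ v → ∃ λ S → Σ (List (Fin V)) λ T → State (v ∷ D) S T × length S ≤ m

  mutual
    -- An unvisited neighbour of the top of the stack is pushed; if there is none, the top becomes
    -- explored. Each push uses up an unvisited vertex, so the recursion runs on the bound `n` for
    -- `length T`. A stack of `m + 1` vertices is the desired path.
    kill : ∀ n {D S T} → length T ≤ n → length S ≤ m → length D < V → State D S T → Path ⊎ Kill D
    -- With nothing left on the stack or unvisited, `size` would give `D` all of the `V` entries.
    kill n {D} {[]} {[]} ht hs hd st = contradiction (trans (sym (+-identityʳ (length D))) (size st)) (<⇒≢ hd)
    kill (suc n) {D} {[]} {t ∷ T} (s≤s ht) hs hd st = advance n ht hs hd (push st [-])
    kill n {D} {s ∷ S} {T} ht hs hd st with neighbour? s T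
    ... | inj₂ h = inj₂ (s , S , T , pop st h , ≤-trans (n≤1+n _) hs)
    kill n {D} {s ∷ S} {T} ht hs hd st | inj₁ (t , a , b) with ∈-∃++ b
    kill zero {D} {s ∷ S} {T} ht hs hd st | inj₁ (t , a , b) | ys , zs , refl =
      contradiction (subst (_≤ 0) (↭-length (shift t ys zs)) ht) λ ()
    kill (suc n) {D} {s ∷ S} {T} ht hs hd st | inj₁ (t , a , b) | ys , zs , refl =
      advance n (≤-pred (subst (_≤ suc n) (↭-length (shift t ys zs)) ht)) hs hd
        (push (reorder (shift t ys zs) st) (a ∷ walk st))

    advance : ∀ n {D t S T} → length T ≤ n → length S ≤ m → length D < V → State D (t ∷ S) T → Path ⊎ Kill D
    advance n {D} {t} {S} {T} ht hs hd st with suc (length S) ≤? m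
    ... | yes hs′ = kill n ht hs′ hd st
    ... | no hs′ = inj₁ (t ∷ S , cong suc (≤-antisym hs (≤-pred (≰⇒> hs′))) , uniqueS st , walk st)

  kill-chunk : ∀ w {D S T} → length S ≤ m → length D + w ≤ V → State D S T →
    Path ⊎ ∃ λ C → ∃ λ S′ → ∃ λ T′ → State (C ++ D) S′ T′ × length S′ ≤ m × length C ≡ w
  kill-chunk zero hs hd st = inj₂ ([] , _ , _ , st , hs , refl)
  kill-chunk (suc w) {D} hs hd st with kill-chunk w hs (≤-trans (+-monoʳ-≤ (length D) (n≤1+n w)) hd) st
  ... | inj₁ p = inj₁ p
  ... | inj₂ (C , S′ , T′ , st′ , hs′ , refl) with kill _ ≤-refl hs′ (≤-trans (≤-reflexive (trans (cong suc (trans (length-++ C) (+-comm (length C) _))) (sym (+-suc (length D) _)))) hd) st′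
  ... | inj₁ p = inj₁ p
  ... | inj₂ (v , S″ , T″ , st″ , hs″) = inj₂ (v ∷ C , S″ , T″ , st″ , hs″ , refl)

  -- A bag will be a chunk together with the stack left once the chunk has been explored. Pairs with
  -- `u ≡ v` are included because the counts that refute a family of covers also run over pairs with
  -- equal ends.
  record Cover (w c : ℕ) (D : List (Fin V)) : Set where
    field
      chunk : Fin c → List (Fin V)
      bag : Fin c → List (Fin V)
      chunk-size : ∀ i → length (chunk i) ≡ w
      bag-size : ∀ i → length (bag i) ≤ w + m
      covers : ∀ {u v} → A u v ⊎ u ≡ v → u ∉ˡ D → v ∉ˡ D →
        ∃ λ i → u ∈ˡ bag i × v ∈ˡ bag i × (u ∈ˡ chunk i ⊎ v ∈ˡ chunk i)

  cover-from : ∀ w c {D S T} → length S ≤ m → length D + c * w ≡ V → State D S T → Path ⊎ Cover w c D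
  cover-from w zero {D} {S} {T} hs hd st = inj₂ record
    { chunk = λ () ; bag = λ () ; chunk-size = λ () ; bag-size = λ ()
    ; covers = λ {u} _ u∉ _ → ⊥-elim (none u u∉) }
    where
    rest : length S + length T ≡ 0
    rest = +-cancelˡ-≡ (length D) _ _ (trans (size st) (sym hd))
    positive : ∀ {u : Fin V} {xs} → u ∈ˡ xs → 0 < length xs
    positive (here _) = s≤s z≤n
    positive (there _) = s≤s z≤n
    none : ∀ u → ¬ u ∉ˡ D
    none u u∉ with covered st u
    ... | inj₁ a = u∉ a
    ... | inj₂ (inj₁ a) = <⇒≢ (<-≤-trans (positive a) (m≤m+n _ _)) (sym rest)
    ... | inj₂ (inj₂ b) = <⇒≢ (<-≤-trans (positive b) (m≤n+m _ (length S))) (sym rest)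
  cover-from w (suc c) {D} {S} {T} hs hd st
    with kill-chunk w hs (≤-trans (+-monoʳ-≤ (length D) (m≤m+n w (c * w))) (≤-reflexive hd)) st
  ... | inj₁ p = inj₁ p
  ... | inj₂ (C , S′ , T′ , st′ , hs′ , refl)
    with cover-from w c hs′ (trans (cong (_+ c * length C) (length-++ C)) (trans (cong (_+ c * length C) (+-comm (length C) (length D))) (trans (+-assoc (length D) _ _) hd))) st′
  ... | inj₁ p = inj₁ p
  ... | inj₂ cov = inj₂ record
    { chunk = λ { zero → C ; (suc i) → chunk i }
    ; bag = λ { zero → C ++ S′ ; (suc i) → bag i }
    ; chunk-size = λ { zero → refl ; (suc i) → chunk-size i }
    ; bag-size = λ { zero → ≤-trans (≤-reflexive (length-++ C)) (+-monoʳ-≤ _ hs′) ; (suc i) → bag-size i }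
    ; covers = go }
    where
    open Cover cov
    -- Explored vertices have no unvisited neighbours, so a neighbour of the chunk that was not
    -- explored before it lies in the chunk or on the stack.
    near : ∀ {u v} → A u v ⊎ u ≡ v → u ∈ˡ C → v ∉ˡ D → v ∈ˡ C ++ S′
    near {u} {v} (inj₂ refl) u∈C _ = ∈-++⁺ˡ u∈C
    near {u} {v} (inj₁ a) u∈C v∉D with covered st′ v
    ... | inj₂ (inj₁ b) = ∈-++⁺ʳ C b
    ... | inj₂ (inj₂ b) = ⊥-elim (separated st′ (∈-++⁺ˡ u∈C) b a)
    ... | inj₁ b with ++⁻ C b
    ... | inj₁ b′ = ∈-++⁺ˡ b′
    ... | inj₂ b′ = ⊥-elim (v∉D b′)
    flip : ∀ {u v} → A u v ⊎ u ≡ v → A v u ⊎ v ≡ u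
    flip (inj₁ a) = inj₁ (A-sym a)
    flip (inj₂ e) = inj₂ (sym e)
    ∉-++ : ∀ {u} → u ∉ˡ C → u ∉ˡ D → u ∉ˡ C ++ D
    ∉-++ a b c = [ a , b ]′ (++⁻ C c)
    go : ∀ {u v} → A u v ⊎ u ≡ v → u ∉ˡ D → v ∉ˡ D → _
    go {u} {v} a u∉ v∉ with u ∈ˡ? C | v ∈ˡ? C
    ... | yes p | _ = zero , ∈-++⁺ˡ p , near a p v∉ , inj₁ p
    ... | no _ | yes q = zero , near (flip a) q u∉ , ∈-++⁺ˡ q , inj₂ q
    ... | no p | no q with covers a (∉-++ p u∉) (∉-++ q v∉)
    ... | i , x = suc i , x

  dfs : ∀ w c → c * w ≡ V → Path ⊎ Cover w c []
  dfs w c e = cover-from w c z≤n e initial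

-- Subsets, images and positions in lists

∈-tabulate⁺ : ∀ {n} {P : Fin n → Set} (P? : ∀ v → Dec (P v)) {v} → P v → v ∈ tabulate (λ x → does (P? x))
∈-tabulate⁺ P? {v} p = lookup⇒[]= v _ (trans (lookup∘tabulate _ v) (dec-true (P? v) p))

∈-tabulate⁻ : ∀ {n} {P : Fin n → Set} (P? : ∀ v → Dec (P v)) {v} → v ∈ tabulate (λ x → does (P? x)) → P v
∈-tabulate⁻ P? {v} h with P? v | trans (sym (lookup∘tabulate (λ x → does (P? x)) v)) ([]=⇒lookup h)
... | yes p | _ = p

∈-image⁺ : ∀ {a b} (φ : Fin a → Fin b) {e v} → v ∈ e → φ v ∈ image φ e
∈-image⁺ φ {e} {v} h = ∈-tabulate⁺ (λ x → any? (λ v → (v ∈? e) ×-dec (φ v ≟ x))) (v , h , refl)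

∈-image⁻ : ∀ {a b} (φ : Fin a → Fin b) {e x} → x ∈ image φ e → ∃ λ v → v ∈ e × φ v ≡ x
∈-image⁻ φ {e} = ∈-tabulate⁻ (λ x → any? (λ v → (v ∈? e) ×-dec (φ v ≟ x)))

∣∣-sum : ∀ {n} (e : Subset n) → ∣ e ∣ ≡ # (_∈? e)
∣∣-sum [] = sym (sum-zero _)
∣∣-sum (true ∷ e) = trans (cong suc (trans (∣∣-sum e) (sum-cong (λ i → []-cong (i ∈? e) (suc i ∈? (true ∷ e)) Vec.there (λ { (Vec.there h) → h }))))) (sym (sum-suc _))
∣∣-sum (false ∷ e) = trans (trans (∣∣-sum e) (sum-cong (λ i → []-cong (i ∈? e) (suc i ∈? (false ∷ e)) Vec.there (λ { (Vec.there h) → h })))) (sym (sum-suc _))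

∣tabulate∣ : ∀ {n} {P : Fin n → Set} (P? : ∀ v → Dec (P v)) → ∣ tabulate (λ x → does (P? x)) ∣ ≡ # P?
∣tabulate∣ P? = trans (∣∣-sum e) (sum-cong (λ i → []-cong (i ∈? e) (P? i) (∈-tabulate⁻ P?) (∈-tabulate⁺ P?)))
  where e = tabulate (λ x → does (P? x))

#-range : ∀ {a n} (f : Fin a → Fin n) → Injective _≡_ _≡_ f → # (λ y → any? (λ o → f o ≟ y)) ≡ a
#-range {a} {n} f inj = trans (sum-cong eq) (sum-#-fibres f)
  where
  eq : ∀ y → [ any? (λ o → f o ≟ y) ] ≡ # (λ o → f o ≟ y)
  eq y with any? (λ o → f o ≟ y)
  ... | yes (o , refl) = sym (trans (sum-cong (λ o′ → []-cong (f o′ ≟ f o) (o′ ≟ o) inj (cong f))) (#-≟′ o))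
  ... | no ¬p = sym (#-none (λ o → f o ≟ y) (λ o e → ¬p (o , e)))

divMod-unique : ∀ d t t′ {o o′} → o < d → o′ < d → o + t * d ≡ o′ + t′ * d → t ≡ t′ × o ≡ o′
divMod-unique d zero zero ho ho′ e = refl , trans (sym (+-identityʳ _)) (trans e (+-identityʳ _))
divMod-unique d zero (suc t′) {o} {o′} ho ho′ e =
  contradiction (≤-trans (≤-trans (m≤m+n d (t′ * d)) (m≤n+m _ o′)) (≤-reflexive (trans (sym e) (+-identityʳ o)))) (<⇒≱ ho)
divMod-unique d (suc t) zero {o} {o′} ho ho′ e =
  contradiction (≤-trans (≤-trans (m≤m+n d (t * d)) (m≤n+m _ o)) (≤-reflexive (trans e (+-identityʳ o′)))) (<⇒≱ ho′)
divMod-unique d (suc t) (suc t′) {o} {o′} ho ho′ e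
  with divMod-unique d t t′ {o} {o′} ho ho′ (+-cancelˡ-≡ d _ _ (trans (swap d o (t * d)) (trans e (sym (swap d o′ (t′ * d))))))
  where
  swap : ∀ d o x → d + (o + x) ≡ o + (d + x)
  swap = solve-∀
... | refl , refl = refl , refl

-- A default value makes indexing total, so that the vertex sequences given to `Embed` can be
-- functions on all of ℕ.
nth : ∀ {a} {A : Set a} → A → List A → ℕ → A
nth d [] t = d
nth d (x ∷ xs) zero = x
nth d (x ∷ xs) (suc t) = nth d xs t

nth-∈ : ∀ {n} (d : Fin n) xs {t} → t < length xs → nth d xs t ∈ˡ xs
nth-∈ d (x ∷ xs) {zero} h = here refl
nth-∈ d (x ∷ xs) {suc t} (s≤s h) = there (nth-∈ d xs h)

nth-injective : ∀ {n} (d : Fin n) {xs} → Unique xs → ∀ {t t′} → t < length xs → t′ < length xs →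
  nth d xs t ≡ nth d xs t′ → t ≡ t′
nth-injective d (_ ∷ _) {zero} {zero} h h′ e = refl
nth-injective d {_ ∷ xs} (x ∷ u) {zero} {suc t′} h (s≤s h′) e = ⊥-elim (All¬⇒¬Any x (subst (_∈ˡ xs) (sym e) (nth-∈ d xs h′)))
nth-injective d {_ ∷ xs} (x ∷ u) {suc t} {zero} (s≤s h) h′ e = ⊥-elim (All¬⇒¬Any x (subst (_∈ˡ xs) e (nth-∈ d xs h)))
nth-injective d (x ∷ u) {suc t} {suc t′} (s≤s h) (s≤s h′) e = cong suc (nth-injective d u h h′ e)

nth-linked : ∀ {n} (d : Fin n) {R : Fin n → Fin n → Set} {xs} → Linked R xs → ∀ {t} → suc t < length xs → R (nth d xs t) (nth d xs (suc t))
nth-linked d [-] {t} (s≤s ())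
nth-linked d (r ∷ l) {zero} h = r
nth-linked d (r ∷ l) {suc t} (s≤s h) = nth-linked d l h

-- Blow-ups of graphs

-- Agrees definitionally with the entries of `edges (path k ℓ m)`.
pathEdge : ∀ k ℓ m → ℕ → Subset (pathV k ℓ m)
pathEdge k ℓ m t = tabulate (λ v → (t * (k ∸ ℓ) ≤ᵇ toℕ v) ∧ (toℕ v <ᵇ t * (k ∸ ℓ) + k))

∈-pathEdge⁺ : ∀ {k ℓ m t v} → t * (k ∸ ℓ) ≤ toℕ v → toℕ v < t * (k ∸ ℓ) + k → v ∈ pathEdge k ℓ m t
∈-pathEdge⁺ {k} {ℓ} {m} {t} {v} p q = lookup⇒[]= v _ (trans (lookup∘tabulate _ v)
  (Equivalence.to T-≡ (Equivalence.from T-∧ (≤⇒≤ᵇ p , <⇒<ᵇ q))))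

∈-pathEdge⁻ : ∀ {k ℓ m t v} → v ∈ pathEdge k ℓ m t → t * (k ∸ ℓ) ≤ toℕ v × toℕ v < t * (k ∸ ℓ) + k
∈-pathEdge⁻ {k} {ℓ} {m} {t} {v} h
  with Equivalence.to (T-∧ {x = t * (k ∸ ℓ) ≤ᵇ toℕ v}) (Equivalence.from T-≡ (trans (sym (lookup∘tabulate _ v)) ([]=⇒lookup h)))
... | p , q = ≤ᵇ⇒≤ _ _ p , <ᵇ⇒< _ _ q

pathV≡ : ∀ k ℓ m → ℓ ≤ k → 1 ≤ m → pathV k ℓ m ≡ ℓ + m * (k ∸ ℓ)
pathV≡ k ℓ (suc m) ℓ≤k _ = trans (cong (_+ m * (k ∸ ℓ)) (sym (m+[n∸m]≡n ℓ≤k))) (+-assoc ℓ (k ∸ ℓ) (m * (k ∸ ℓ)))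

-- Vertices of the blow-up: x blocks of ℓ linking vertices, then p blocks of q private vertices.
module Blowup (ℓ q x p : ℕ) where

  k : ℕ
  k = ℓ + (q + ℓ)

  N : ℕ
  N = x * ℓ + p * q

  link : Fin x → Fin ℓ → Fin N
  link a o = combine a o ↑ˡ (p * q)

  priv : Fin p → Fin q → Fin N
  priv j o = x * ℓ ↑ʳ combine j o

  link-injective : ∀ {a o a′ o′} → link a o ≡ link a′ o′ → a ≡ a′ × o ≡ o′
  link-injective e = combine-injective _ _ _ _ (↑ˡ-injective (p * q) _ _ e)

  priv-injective : ∀ {j o j′ o′} → priv j o ≡ priv j′ o′ → j ≡ j′ × o ≡ o′
  priv-injective e = combine-injective _ _ _ _ (↑ʳ-injective (x * ℓ) _ _ e)

  link≢priv : ∀ {a o j o′} → link a o ≢ priv j o′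
  link≢priv {a} {o} {j} {o′} e with trans (sym (splitAt-↑ˡ (x * ℓ) (combine a o) (p * q))) (trans (cong (splitAt (x * ℓ)) e) (splitAt-↑ʳ (x * ℓ) (p * q) (combine j o′)))
  ... | ()

  InLink : Fin x → Fin N → Set
  InLink a y = ∃ λ o → link a o ≡ y

  InPriv : Fin p → Fin N → Set
  InPriv j y = ∃ λ o → priv j o ≡ y

  link? : ∀ a y → Dec (InLink a y)
  link? a y = any? (λ o → link a o ≟ y)

  priv? : ∀ j y → Dec (InPriv j y)
  priv? j y = any? (λ o → priv j o ≟ y)

  InEdge : Fin x → Fin x → Fin p → Fin N → Set
  InEdge a b j y = InLink a y ⊎ (InPriv j y ⊎ InLink b y)

  inEdge? : ∀ a b j y → Dec (InEdge a b j y)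
  inEdge? a b j y = link? a y ⊎-dec (priv? j y ⊎-dec link? b y)

  opaque
    E : Fin x → Fin x → Fin p → Subset N
    E a b j = tabulate (λ y → does (inEdge? a b j y))

    ∈E⁺ : ∀ {a b j y} → InEdge a b j y → y ∈ E a b j
    ∈E⁺ {a} {b} {j} = ∈-tabulate⁺ (inEdge? a b j)

    ∈E⁻ : ∀ {a b j y} → y ∈ E a b j → InEdge a b j y
    ∈E⁻ {a} {b} {j} = ∈-tabulate⁻ (inEdge? a b j)

    ∣E∣-# : ∀ a b j → ∣ E a b j ∣ ≡ # (inEdge? a b j)
    ∣E∣-# a b j = ∣tabulate∣ (inEdge? a b j)

  E-sym : ∀ a b j → E a b j ≡ E b a j
  E-sym a b j = ⊆-antisym (sub a b) (sub b a)
    where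
    sub : ∀ a b → E a b j ⊆ E b a j
    sub a b h = ∈E⁺ (swap (∈E⁻ h))
      where
      swap : ∀ {A B C : Set} → A ⊎ (B ⊎ C) → C ⊎ (B ⊎ A)
      swap (inj₁ x) = inj₂ (inj₂ x)
      swap (inj₂ (inj₁ x)) = inj₂ (inj₁ x)
      swap (inj₂ (inj₂ x)) = inj₁ x

  #link : ∀ a → # (link? a) ≡ ℓ
  #link a = #-range (link a) (proj₂ ∘ link-injective)

  #priv : ∀ j → # (priv? j) ≡ q
  #priv j = #-range (priv j) (proj₂ ∘ priv-injective)

  -- The three blocks of the edge are pairwise disjoint, the two linking blocks because `a ≢ b`.
  ∣E∣ : ∀ {a b} j → a ≢ b → ∣ E a b j ∣ ≡ k
  ∣E∣ {a} {b} j a≢b = trans (∣E∣-# a b j) (≤-antisym upper lower)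
    where
    pl? : ∀ y → Dec (InPriv j y ⊎ InLink b y)
    pl? y = priv? j y ⊎-dec link? b y
    upper : # (inEdge? a b j) ≤ k
    upper = ≤-trans (#-⊎ (inEdge? a b j) (link? a) pl? (λ _ h → h))
      (+-mono-≤ (≤-reflexive (#link a)) (≤-trans (#-⊎ pl? (priv? j) (link? b) (λ _ h → h))
        (≤-reflexive (cong₂ _+_ (#priv j) (#link b)))))
    disj : ∀ y → InLink a y → InPriv j y ⊎ InLink b y → ⊥
    disj y (o , e) (inj₁ (o′ , e′)) = link≢priv (trans e (sym e′))
    disj y (o , e) (inj₂ (o′ , e′)) = a≢b (proj₁ (link-injective (trans e (sym e′))))
    lower : k ≤ # (inEdge? a b j)
    lower = ≤-trans (+-mono-≤ (≤-reflexive (sym (#link a)))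
        (≤-trans (≤-reflexive (sym (cong₂ _+_ (#priv j) (#link b))))
          (#-split (priv? j) (link? b) pl? (λ { y (o , e) (o′ , e′) → link≢priv (trans e′ (sym e)) }) (λ _ h → h))))
      (#-split (link? a) pl? (inEdge? a b j) disj (λ _ h → h))

  -- Position `o + t * d` of the path, with `o < d` and `d = k ∸ ℓ`, goes to linking block `a t` if
  -- `o < ℓ` and to private block `j t` otherwise. Path edge `t` then occupies linking block `a t`,
  -- private block `j t` and linking block `a (suc t)`.
  module Embed {m} (1≤m : 1 ≤ m) (1≤ℓ : 1 ≤ ℓ) (a : ℕ → Fin x) (j : ℕ → Fin p)
    (a-inj : ∀ {t t′} → t < suc m → t′ < suc m → a t ≡ a t′ → t ≡ t′)
    (j-inj : ∀ {t t′} → t < m → t′ < m → j t ≡ j t′ → t ≡ t′) where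

    d : ℕ
    d = ℓ + q

    k∸ℓ≡d : k ∸ ℓ ≡ d
    k∸ℓ≡d = trans (m+n∸m≡n ℓ (q + ℓ)) (+-comm q ℓ)

    ℓ≤k : ℓ ≤ k
    ℓ≤k = m≤m+n ℓ (q + ℓ)

    instance
      d≢0 : NonZero d
      d≢0 = >-nonZero (≤-trans 1≤ℓ (m≤m+n ℓ q))

    n : ℕ
    n = pathV k ℓ m

    n≡ : n ≡ ℓ + m * d
    n≡ = trans (pathV≡ k ℓ m ℓ≤k 1≤m) (cong (λ z → ℓ + m * z) k∸ℓ≡d)

    -- The bound on `o` is irrelevant, so equal coordinates have equal images whatever the proofs of
    -- their bounds.
    place : (t o : ℕ) → .(o < d) → Fin N
    place t o o<d with o <? ℓ
    ... | yes o<ℓ = link (a t) (fromℕ< o<ℓ)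
    ... | no o≮ℓ = priv (j t) (fromℕ< {o ∸ ℓ} (+-cancelˡ-< ℓ _ _ (subst (_< d) (sym (m+[n∸m]≡n (≮⇒≥ o≮ℓ))) (recompute (o <? d) o<d))))

    -- The last period `t = m` consists of linking vertices only, hence the second condition.
    Valid : ℕ → ℕ → Set
    Valid t o = t < suc m × (ℓ ≤ o → t < m)

    place-injective : ∀ {t o t′ o′} .(h : o < d) .(h′ : o′ < d) → Valid t o → Valid t′ o′ →
      place t o h ≡ place t′ o′ h′ → t ≡ t′ × o ≡ o′
    place-injective {t} {o} {t′} {o′} h h′ (v , w) (v′ , w′) e with o <? ℓ | o′ <? ℓ
    ... | yes r | yes r′ with link-injective e
    ... | e₁ , e₂ = a-inj v v′ e₁ , fromℕ<-injective _ _ r r′ e₂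
    place-injective h h′ _ _ e | yes r | no r′ = ⊥-elim (link≢priv e)
    place-injective h h′ _ _ e | no r | yes r′ = ⊥-elim (link≢priv (sym e))
    place-injective {t} {o} {t′} {o′} h h′ (v , w) (v′ , w′) e | no r | no r′ with priv-injective e
    ... | e₁ , e₂ = j-inj (w (≮⇒≥ r)) (w′ (≮⇒≥ r′)) e₁
        , trans (sym (m+[n∸m]≡n (≮⇒≥ r))) (trans (cong (ℓ +_) (fromℕ<-injective _ _ _ _ e₂)) (m+[n∸m]≡n (≮⇒≥ r′)))

    φ : Fin n → Fin N
    φ v = place (toℕ v / d) (toℕ v % d) (m%n<n (toℕ v) d)

    valid : ∀ t o → o < d → o + t * d < n → Valid t o
    valid t o o<d h = t<1+m , ≰-case
      where
      h′ : o + t * d < ℓ + m * d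
      h′ = subst (o + t * d <_) n≡ h
      t<1+m : t < suc m
      t<1+m = ≰⇒> λ m<t → <⇒≱ h′ (≤-trans (+-monoˡ-≤ (m * d) (m≤m+n ℓ q)) (≤-trans (*-monoˡ-≤ d m<t) (m≤n+m _ o)))
      ≰-case : ℓ ≤ o → t < m
      ≰-case ℓ≤o = ≰⇒> λ m≤t → <⇒≱ h′ (+-mono-≤ ℓ≤o (*-monoˡ-≤ d m≤t))

    φ-at : ∀ (v : Fin n) t o (o<d : o < d) → toℕ v ≡ o + t * d → φ v ≡ place t o o<d
    φ-at v t o o<d e with divMod-unique d (toℕ v / d) t (m%n<n (toℕ v) d) o<d (trans (sym (m≡m%n+[m/n]*n (toℕ v) d)) e)
    ... | e₁ , e₂ = help e₁ e₂ _ _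
      where
      help : ∀ {t t′ o o′} → t ≡ t′ → o ≡ o′ → .(h : o < d) .(h′ : o′ < d) → place t o h ≡ place t′ o′ h′
      help refl refl h h′ = refl

    φ-injective : Injective _≡_ _≡_ φ
    φ-injective {v} {w} e with place-injective (m%n<n (toℕ v) d) (m%n<n (toℕ w) d) (valid _ _ (m%n<n (toℕ v) d) (bound v)) (valid _ _ (m%n<n (toℕ w) d) (bound w)) e
      where
      bound : ∀ (v : Fin n) → toℕ v % d + toℕ v / d * d < n
      bound v = subst (_< n) (m≡m%n+[m/n]*n (toℕ v) d) (toℕ<n v)
    ... | e₁ , e₂ = toℕ-injective (trans (m≡m%n+[m/n]*n (toℕ v) d) (trans (cong₂ (λ t o → o + t * d) e₁ e₂) (sym (m≡m%n+[m/n]*n (toℕ w) d))))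

    place-link : ∀ t o (o<d : o < d) (o<ℓ : o < ℓ) → place t o o<d ≡ link (a t) (fromℕ< o<ℓ)
    place-link t o o<d o<ℓ with o <? ℓ
    ... | yes _ = refl
    ... | no ¬p = contradiction o<ℓ ¬p

    place-priv : ∀ t o (o<q : o < q) (o<d : ℓ + o < d) → place t (ℓ + o) o<d ≡ priv (j t) (fromℕ< o<q)
    place-priv t o o<q o<d with ℓ + o <? ℓ
    ... | yes p = contradiction p (≤⇒≯ (m≤m+n ℓ o))
    ... | no ¬p = cong (priv (j t)) (toℕ-injective (trans (toℕ-fromℕ< _) (trans (m+n∸m≡n ℓ o) (sym (toℕ-fromℕ< o<q)))))

    place-InEdge : ∀ t o (o<d : o < d) {b y} → place t o o<d ≡ y → InEdge (a t) b (j t) y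
    place-InEdge t o o<d e with o <? ℓ
    ... | yes _ = inj₁ (_ , e)
    ... | no _ = inj₂ (inj₁ (_ , e))

    vertex : ∀ v → v < n → Fin n
    vertex v h = fromℕ< h

    image-edge : ∀ {t} → t < m → image φ (pathEdge k ℓ m t) ≡ E (a t) (a (suc t)) (j t)
    image-edge {t} t<m = ⊆-antisym to from
      where
      to : image φ (pathEdge k ℓ m t) ⊆ E (a t) (a (suc t)) (j t)
      to h with ∈-image⁻ φ h
      ... | v , v∈ , e with ∈-pathEdge⁻ {k} {ℓ} {m} {t} v∈
      ... | lo , hi = ∈E⁺ (go e)
        where
        td = t * d
        lo′ : td ≤ toℕ v
        lo′ = subst (λ z → t * z ≤ toℕ v) k∸ℓ≡d lo
        o = toℕ v ∸ td
        v≡ : toℕ v ≡ o + t * d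
        v≡ = sym (m∸n+n≡m lo′)
        o<k : o < d + ℓ
        o<k = +-cancelʳ-< td o (d + ℓ) (subst₂ _<_ v≡ (trans (cong (λ z → t * z + k) k∸ℓ≡d) (trans (+-comm (t * d) k) (cong (_+ t * d) (sym (+-assoc ℓ q ℓ))))) hi)
        go : ∀ {y} → φ v ≡ y → InEdge (a t) (a (suc t)) (j t) y
        go e with o <? d
        ... | yes o<d = place-InEdge t o o<d (trans (sym (φ-at v t o o<d v≡)) e)
        -- An offset of at least `d` has passed into the linking block of the next period.
        ... | no o≮d = inj₂ (inj₂ (fromℕ< o′<ℓ , trans (sym (place-link (suc t) o′ o′<d o′<ℓ)) (trans (sym (φ-at v (suc t) o′ o′<d v≡′)) e)))
          where
          o′ = o ∸ d
          d≤o = ≮⇒≥ o≮d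
          o′<ℓ : o′ < ℓ
          o′<ℓ = +-cancelˡ-< d o′ ℓ (subst (_< d + ℓ) (sym (m+[n∸m]≡n d≤o)) o<k)
          o′<d : o′ < d
          o′<d = ≤-trans o′<ℓ (m≤m+n ℓ q)
          v≡′ : toℕ v ≡ o′ + (d + t * d)
          v≡′ = trans v≡ (trans (cong (_+ t * d) (sym (m∸n+n≡m d≤o))) (+-assoc o′ d (t * d)))
      from : E (a t) (a (suc t)) (j t) ⊆ image φ (pathEdge k ℓ m t)
      from {y} h with ∈E⁻ h
      ... | r = go r
        where
        put : ∀ s o (o<d : o < d) → t * d ≤ o + s * d → o + s * d < t * d + (d + ℓ) → place s o o<d ≡ y → y ∈ image φ (pathEdge k ℓ m t)
        put s o o<d lo hi e = subst (_∈ image φ (pathEdge k ℓ m t)) (trans (φ-at w s o o<d w≡) e)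
          (∈-image⁺ φ (∈-pathEdge⁺ {k} {ℓ} {m} {t} (subst₂ _≤_ (cong (t *_) (sym k∸ℓ≡d)) (sym w≡) lo)
            (subst₂ _<_ (sym w≡) (cong₂ _+_ (cong (t *_) (sym k∸ℓ≡d)) (+-assoc ℓ q ℓ)) hi)))
          where
          w<n : o + s * d < n
          w<n = ≤-trans hi (≤-trans (≤-reflexive (trans (sym (+-assoc (t * d) d ℓ)) (trans (+-comm _ ℓ) (cong (ℓ +_) (+-comm (t * d) d)))))
                  (≤-trans (+-monoʳ-≤ ℓ (*-monoˡ-≤ d t<m)) (≤-reflexive (sym n≡))))
          w = vertex (o + s * d) w<n
          w≡ : toℕ w ≡ o + s * d
          w≡ = toℕ-fromℕ< w<n
        go : InEdge (a t) (a (suc t)) (j t) y → y ∈ image φ (pathEdge k ℓ m t)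
        go (inj₁ (o , e)) = put t (toℕ o) o<d (m≤n+m _ _)
            (subst (_< t * d + (d + ℓ)) (+-comm (t * d) (toℕ o)) (+-monoʳ-< (t * d) (≤-trans o<d (m≤m+n d ℓ))))
            (trans (place-link t (toℕ o) o<d (toℕ<n o)) (trans (cong (link (a t)) (fromℕ<-toℕ o (toℕ<n o))) e))
          where o<d = ≤-trans (toℕ<n o) (m≤m+n ℓ q)
        go (inj₂ (inj₁ (o , e))) = put t (ℓ + toℕ o) o<d (m≤n+m _ _)
            (subst (_< t * d + (d + ℓ)) (+-comm (t * d) (ℓ + toℕ o)) (+-monoʳ-< (t * d) (≤-trans o<d (m≤m+n d ℓ))))
            (trans (place-priv t (toℕ o) (toℕ<n o) o<d) (trans (cong (priv (j t)) (fromℕ<-toℕ o (toℕ<n o))) e))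
          where o<d = +-monoʳ-< ℓ (toℕ<n o)
        go (inj₂ (inj₂ (o , e))) = put (suc t) (toℕ o) o<d (≤-trans (m≤n+m (t * d) d) (m≤n+m (d + t * d) (toℕ o)))
            (subst₂ _<_ (+-comm (d + t * d) (toℕ o)) (trans (cong (_+ ℓ) (+-comm d (t * d))) (+-assoc (t * d) d ℓ)) (+-monoʳ-< (d + t * d) (toℕ<n o)))
            (trans (place-link (suc t) (toℕ o) o<d (toℕ<n o)) (trans (cong (link (a (suc t))) (fromℕ<-toℕ o (toℕ<n o))) e))
          where o<d = ≤-trans (toℕ<n o) (m≤m+n ℓ q)

    monoCopy : ∀ {r} es (c : Colouring r (hg N es)) i →
      (∀ t → t < m → Σ (Fin (length es)) λ f → (lookup es f ≡ E (a t) (a (suc t)) (j t)) × (c f ≡ i)) →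
      MonoCopy r (hg N es) c (path k ℓ m)
    monoCopy es c i h = φ , φ-injective , i , AllP.map⁺ (applyUpTo⁺₁ id m λ {t} t<m →
      let f , e , g = h t t<m in f , trans e (sym (image-edge t<m)) , g)

-- Blow-ups as hosts, and a dense host

_≟ˢ_ : ∀ {n} (e e′ : Subset n) → Dec (e ≡ e′)
_≟ˢ_ = ≡-dec _≟ᵇ_

∑-comm₂ : ∀ {a b c} (f : Fin a → Fin b → Fin c → ℕ) →
  sum (λ u → sum (λ i → sum (λ j → f u i j))) ≡ sum (λ i → sum (λ j → sum (λ u → f u i j)))
∑-comm₂ f = trans (∑-comm (λ u i → sum (λ j → f u i j))) (sum-cong (λ i → ∑-comm (λ u j → f u i j)))

∑∑-* : ∀ {a b} (f : Fin a → ℕ) (g : Fin b → ℕ) → sum (λ u → sum (λ v → f u * g v)) ≡ sum f * sum g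
∑∑-* f g = trans (sum-cong (λ u → sym (*-distribˡ-sum (f u) g))) (sym (*-distribʳ-sum (sum g) f))

-- Filtering by size guards against triples with coinciding ends, and deduplication merges the two
-- orientations of a pair, which give the same edge.
module Host (ℓ q x p : ℕ) (Ts : List (Fin x × Fin x × Fin p)) where
  open Blowup ℓ q x p public

  edge : Fin x × Fin x × Fin p → Subset N
  edge (a , b , j) = E a b j

  candidates : List (Subset N)
  candidates = filter (λ e → ∣ e ∣ ≟ℕ k) (map edge Ts)

  es : List (Subset N)
  es = deduplicate _≟ˢ_ candidates

  host : Hypergraph
  host = hg N es

  host-kGraph : IsKGraph k host
  host-kGraph = deduplicate-! _≟ˢ_ candidates , AllP.deduplicate⁺ _≟ˢ_ (all-filter (λ e → ∣ e ∣ ≟ℕ k) (map edge Ts))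

  ne-host : ne host ≤ length Ts
  ne-host = ≤-trans (length-deduplicate _≟ˢ_ candidates) (≤-trans (length-filter (λ e → ∣ e ∣ ≟ℕ k) (map edge Ts)) (≤-reflexive (length-map edge Ts)))

  opaque
    host-index : ∀ {a b j} → (a , b , j) ∈ˡ Ts → a ≢ b → Σ (Fin (length es)) λ f → lookup es f ≡ E a b j
    host-index {a} {b} {j} h a≢b = index h′ , sym (lookup-index h′)
      where
      h′ : E a b j ∈ˡ es
      h′ = ∈-deduplicate⁺ _≟ˢ_ (∈-filter⁺ (λ e → ∣ e ∣ ≟ℕ k) (∈-map⁺ edge h) (∣E∣ j a≢b))

  module Coloured {r} (c : Colouring r host) where
    HasEdge : Fin r → Fin x → Fin x → Fin p → Set
    HasEdge i a b j = Σ (Fin (length es)) λ f → (lookup es f ≡ E a b j) × (c f ≡ i)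

    hasEdge? : ∀ i a b j → Dec (HasEdge i a b j)
    hasEdge? i a b j = any? (λ f → (lookup es f ≟ˢ E a b j) ×-dec (c f ≟ i))

    hasEdge-sym : ∀ {i a b j} → HasEdge i a b j → HasEdge i b a j
    hasEdge-sym {i} {a} {b} {j} (f , e , g) = f , trans e (E-sym a b j) , g

-- The chunks are singletons, so a pair meeting a chunk inside its bag is counted at most
-- 2 (1 + m) times per chunk, while there are x² pairs to be covered.
covering-bound : ∀ s x m (chunk bag : Fin s → Fin x → List (Fin x)) →
  (∀ i c → length (chunk i c) ≡ 1) → (∀ i c → length (bag i c) ≤ 1 + m) →
  (∀ u v → ∃₂ λ i c → u ∈ˡ bag i c × v ∈ˡ bag i c × (u ∈ˡ chunk i c ⊎ v ∈ˡ chunk i c)) →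
  x * x ≤ s * (x * (2 * (1 + m)))
covering-bound s x m chunk bag chunk-size bag-size covered = begin
  x * x ≡⟨ sym (trans (sum-cong (λ u → trans (sum-const x 1) (*-identityʳ x))) (sum-const x x)) ⟩
  sum {x} (λ u → sum {x} (λ v → 1)) ≤⟨ sum-mono (λ u → sum-mono (λ v → 1≤g u v)) ⟩
  sum (λ u → sum (λ v → sum (λ i → sum (λ c → g u v i c)))) ≡⟨ sum-cong (λ u → ∑-comm₂ (g u)) ⟩
  sum (λ u → sum (λ i → sum (λ c → sum (λ v → g u v i c)))) ≡⟨ ∑-comm₂ (λ u i c → sum (λ v → g u v i c)) ⟩
  sum (λ i → sum (λ c → sum (λ u → sum (λ v → g u v i c)))) ≤⟨ sum-bound (λ i → sum-bound (cell i)) ⟩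
  s * (x * (2 * (1 + m))) ∎
  where
  open ≤-Reasoning
  inC inB : Fin s → Fin x → Fin x → ℕ
  inC i c u = [ u ∈ˡ? chunk i c ]
  inB i c u = [ u ∈ˡ? bag i c ]
  g : Fin x → Fin x → Fin s → Fin x → ℕ
  g u v i c = inC i c u * inB i c v + inB i c u * inC i c v
  1≤g : ∀ u v → 1 ≤ sum (λ i → sum (λ c → g u v i c))
  1≤g u v with covered u v
  ... | i , c , u∈ , v∈ , w = ≤-trans (one w) (≤-trans (term≤sum (g u v i) c) (term≤sum (λ i → sum (g u v i)) i))
    where
    one : _ → 1 ≤ g u v i c
    one (inj₁ u∈C) = ≤-trans (≤-reflexive (sym (cong₂ _*_ ([]-yes (u ∈ˡ? chunk i c) u∈C) ([]-yes (v ∈ˡ? bag i c) v∈)))) (m≤m+n _ _)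
    one (inj₂ v∈C) = ≤-trans (≤-reflexive (sym (cong₂ _*_ ([]-yes (u ∈ˡ? bag i c) u∈) ([]-yes (v ∈ˡ? chunk i c) v∈C)))) (m≤n+m _ _)
  cell : ∀ i c → sum (λ u → sum (λ v → g u v i c)) ≤ 2 * (1 + m)
  cell i c = ≤-trans (≤-reflexive (trans
      (sum-cong (λ u → ∑-distrib-+ (λ v → inC i c u * inB i c v) (λ v → inB i c u * inC i c v)))
      (trans (∑-distrib-+ (λ u → sum (λ v → inC i c u * inB i c v)) (λ u → sum (λ v → inB i c u * inC i c v)))
        (cong₂ _+_ (∑∑-* (inC i c) (inB i c)) (∑∑-* (inB i c) (inC i c))))))
    (≤-trans (+-mono-≤ (*-mono-≤ C≤1 B≤) (*-mono-≤ B≤ C≤1)) (≤-reflexive (arith (1 + m))))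
    where
    C≤1 : sum (inC i c) ≤ 1
    C≤1 = ≤-trans (#-∈ˡ (chunk i c)) (≤-reflexive (chunk-size i c))
    B≤ : sum (inB i c) ≤ 1 + m
    B≤ = ≤-trans (#-∈ˡ (bag i c)) (bag-size i c)
    arith : ∀ y → 1 * y + y * 1 ≡ 2 * y
    arith = solve-∀

-- Every pair of distinct graph vertices is joined through all `p` private blocks. Since `p` exceeds
-- `s * m`, each such pair has a colour that occurs on more than `m` of its blocks. If no colour had
-- a path, the covers of the `s` colours would contain all `x * x` pairs, which `covering-bound`
-- excludes for such large `x`.
module DenseHost (ℓ q s m x p : ℕ) (1≤ℓ : 1 ≤ ℓ) (1≤m : 1 ≤ m)
  (x-large : s * (2 * (1 + m)) < x) (p-large : s * m < p)
  (u₀ v₀ : Fin x) (u₀≢v₀ : u₀ ≢ v₀) (j₀ : Fin p) where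

  Ts : List (Fin x × Fin x × Fin p)
  Ts = cartesianProduct (allFin x) (cartesianProduct (allFin x) (allFin p))

  open Host ℓ q x p Ts

  module _ (c : Colouring s host) where
    open Coloured c

    A : Fin s → Fin x → Fin x → Set
    A i a b = m < # (hasEdge? i a b)

    A? : ∀ i a b → Dec (A i a b)
    A? i a b = m <? # (hasEdge? i a b)

    A-sym : ∀ i {a b} → A i a b → A i b a
    A-sym i {a} {b} h = ≤-trans h (#-mono (hasEdge? i a b) (hasEdge? i b a) (λ j → hasEdge-sym {i} {a} {b} {j}))

    idx : ∀ {a b} → a ≢ b → ∀ j → Σ (Fin (length es)) λ f → lookup es f ≡ E a b j
    idx {a} {b} a≢b j = host-index (∈-cartesianProduct⁺ (∈-allFin a) (∈-cartesianProduct⁺ (∈-allFin b) (∈-allFin j))) a≢b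

    χ : ∀ {a b} → a ≢ b → Fin p → Fin s
    χ a≢b j = c (proj₁ (idx a≢b j))

    colour : ∀ a b → a ≢ b → ∃ λ i → A i a b
    colour a b a≢b with rich-fibre {c = m} (χ a≢b) p-large
    ... | i , h = i , ≤-trans h (#-mono (λ j → χ a≢b j ≟ i) (hasEdge? i a b) (λ j e → _ , proj₂ (idx a≢b j) , e))

    private module D i = DFS (A i) (A? i) (λ {u} {v} → A-sym i {u} {v}) m

    -- Private blocks are chosen greedily: the rest of the path has used fewer than `m` of them,
    -- whereas an adjacent pair offers more than `m`.
    representatives : ∀ i {d d′} xs → Linked (A i) xs → length xs ≤ suc m →
      ∃ λ J → length J ≡ length xs ∸ 1 × Unique J ×
        (∀ {t} → t < length J → HasEdge i (nth d xs t) (nth d xs (suc t)) (nth d′ J t))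
    representatives i [] l h = [] , refl , [] , λ ()
    representatives i (a ∷ []) l h = [] , refl , [] , λ ()
    representatives i {d} {d′} (a ∷ b ∷ xs) (r ∷ l) (s≤s h)
      with representatives i {d} {d′} (b ∷ xs) l (≤-trans h (n≤1+n m))
    ... | J , e , u , H
      with #-fresh (hasEdge? i a b) J (≤-trans (s≤s (≤-trans (≤-reflexive e) (≤-trans (n≤1+n _) h))) r)
    ... | j , g , j∉ = j ∷ J , cong suc e , ¬Any⇒All¬ _ j∉ ∷ u , λ { {zero} _ → g ; {suc t} (s≤s t<) → H t< }

    path⇒copy : ∀ i → D.Path i → MonoCopy s host c (path k ℓ m)
    path⇒copy i (a ∷ S , e , uS , lS) with representatives i {a} {j₀} (a ∷ S) lS (≤-reflexive e)
    ... | J , e′ , uJ , H = Embed.monoCopy 1≤m 1≤ℓ (nth a (a ∷ S)) (nth j₀ J)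
        (λ {t} {t′} h h′ → nth-injective a uS (subst (t <_) (sym e) h) (subst (t′ <_) (sym e) h′))
        (λ {t} {t′} h h′ → nth-injective j₀ uJ (subst (t <_) (sym J≡m) h) (subst (t′ <_) (sym J≡m) h′))
        es c i (λ t t<m → H (subst (t <_) (sym J≡m) t<m))
      where
      J≡m : length J ≡ m
      J≡m = trans e′ (suc-injective e)

    no-covers : ¬ (∀ i → D.Cover i 1 x [])
    no-covers cov = <⇒≱ x-large (*-cancelˡ-≤ x (≤-trans
        (covering-bound s x m chunk bag chunk-size bag-size covered) (≤-reflexive (swap s x (2 * (1 + m))))))
      where
      open module C i = D.Cover i (cov i)
      instance
        x≢0 : NonZero x
        x≢0 = >-nonZero (≤-trans (s≤s z≤n) x-large)
      swap : ∀ s x y → s * (x * y) ≡ x * (s * y)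
      swap = solve-∀
      covered : ∀ u v → ∃₂ λ i c → u ∈ˡ bag i c × v ∈ˡ bag i c × (u ∈ˡ chunk i c ⊎ v ∈ˡ chunk i c)
      covered u v with u ≟ v
      -- A pair with equal entries is covered in any colour; as `s` may be 0, a colour has to be
      -- obtained from an actual pair.
      ... | yes e = _ , covers (proj₁ (colour u₀ v₀ u₀≢v₀)) (inj₂ e) (λ ()) (λ ())
      ... | no u≢v with colour u v u≢v
      ... | i , h = i , covers i (inj₁ h) (λ ()) (λ ())

    copy : MonoCopy s host c (path k ℓ m)
    copy with ∀⊎⇒ (λ i → D.dfs i 1 x (*-identityʳ x))
    ... | inj₁ (i , P) = path⇒copy i P
    ... | inj₂ cov = ⊥-elim (no-covers cov)

  dense-host : Σ Hypergraph λ G → IsKGraph k G × Arrows G s (path k ℓ m) × nv G ≡ N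
  dense-host = host , host-kGraph , copy , refl

-- A graph with few edges inside small sets

Σˢ : ∀ n → (Subset n → ℕ) → ℕ
Σˢ zero f = f []
Σˢ (suc n) f = Σˢ n (f ∘ (true ∷_)) + Σˢ n (f ∘ (false ∷_))

Σˢ-mono : ∀ n {f g : Subset n → ℕ} → (∀ U → f U ≤ g U) → Σˢ n f ≤ Σˢ n g
Σˢ-mono zero h = h []
Σˢ-mono (suc n) h = +-mono-≤ (Σˢ-mono n (h ∘ (true ∷_))) (Σˢ-mono n (h ∘ (false ∷_)))

Σˢ-cong : ∀ n {f g : Subset n → ℕ} → (∀ U → f U ≡ g U) → Σˢ n f ≡ Σˢ n g
Σˢ-cong n h = ≤-antisym (Σˢ-mono n (≤-reflexive ∘ h)) (Σˢ-mono n (≤-reflexive ∘ sym ∘ h))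

term≤Σˢ : ∀ {n} (f : Subset n → ℕ) U → f U ≤ Σˢ n f
term≤Σˢ f [] = ≤-refl
term≤Σˢ f (true ∷ U) = ≤-trans (term≤Σˢ (f ∘ (true ∷_)) U) (m≤m+n _ _)
term≤Σˢ f (false ∷ U) = ≤-trans (term≤Σˢ (f ∘ (false ∷_)) U) (m≤n+m _ _)

*-Σˢ : ∀ n c (f : Subset n → ℕ) → c * Σˢ n f ≡ Σˢ n (λ U → c * f U)
*-Σˢ zero c f = refl
*-Σˢ (suc n) c f = trans (*-distribˡ-+ c _ _) (cong₂ _+_ (*-Σˢ n c _) (*-Σˢ n c _))

sum-Σˢ : ∀ {a} n (f : Fin a → Subset n → ℕ) → sum (λ u → Σˢ n (f u)) ≡ Σˢ n (λ U → sum (λ u → f u U))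
sum-Σˢ zero f = refl
sum-Σˢ (suc n) f = trans (∑-distrib-+ (λ u → Σˢ n (f u ∘ (true ∷_))) (λ u → Σˢ n (f u ∘ (false ∷_)))) (cong₂ _+_ (sum-Σˢ n _) (sum-Σˢ n _))

-- The binomial theorem over subsets: an element contributes a factor 1 if it lies in `U` and `ρ`
-- otherwise.
Σˢ-binomial : ∀ n ρ → Σˢ n (λ U → ρ ^ (n ∸ ∣ U ∣)) ≡ (ρ + 1) ^ n
Σˢ-binomial zero ρ = refl
Σˢ-binomial (suc n) ρ = trans (cong₂ _+_ (Σˢ-binomial n ρ)
    (trans (Σˢ-cong n (λ U → cong (ρ ^_) (+-∸-assoc 1 (∣p∣≤n U)))) (trans (sym (*-Σˢ n ρ _)) (cong (ρ *_) (Σˢ-binomial n ρ)))))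
  (arith ρ ((ρ + 1) ^ n))
  where
  arith : ∀ ρ x → x + ρ * x ≡ (ρ + 1) * x
  arith = solve-∀

-- Bernoulli's inequality `(1 - 1/(t+1))^n ≥ 1 - n/(t+1)`, multiplied by `(t+1)^(n+1)` and
-- rearranged to avoid subtraction.
bernoulli : ∀ t n → (t + 1) * (t + 1) ^ n ≤ t ^ n * (t + 1) + n * (t + 1) ^ n
bernoulli t zero = ≤-reflexive (arith t)
  where
  arith : ∀ t → (t + 1) * 1 ≡ 1 * (t + 1) + 0
  arith = solve-∀
bernoulli t (suc n) = begin
  (t + 1) * ((t + 1) * y) ≡⟨ a₁ t y ⟩
  t * ((t + 1) * y) + (t + 1) * y ≤⟨ +-monoˡ-≤ ((t + 1) * y) (*-monoʳ-≤ t (bernoulli t n)) ⟩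
  t * (t ^ n * (t + 1) + n * y) + (t + 1) * y ≤⟨ m≤m+n _ (n * y) ⟩
  t * (t ^ n * (t + 1) + n * y) + (t + 1) * y + n * y ≡⟨ a₂ t (t ^ n) n y ⟩
  t * t ^ n * (t + 1) + suc n * ((t + 1) * y) ∎
  where
  open ≤-Reasoning
  y = (t + 1) ^ n
  a₁ : ∀ t y → (t + 1) * ((t + 1) * y) ≡ t * ((t + 1) * y) + (t + 1) * y
  a₁ = solve-∀
  a₂ : ∀ t x n y → t * (x * (t + 1) + n * y) + (t + 1) * y + n * y ≡ t * x * (t + 1) + (1 + n) * ((t + 1) * y)
  a₂ = solve-∀

-- The hypothesis makes the error term `n/(t+1)` in Bernoulli's inequality at most one half.
[t+1]^n≤2t^n : ∀ t n → 2 * n ≤ t + 1 → (t + 1) ^ n ≤ 2 * t ^ n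
[t+1]^n≤2t^n t n h = *-cancelˡ-≤ (t + 1) {{>-nonZero (m≤n+m 1 t)}} (+-cancelʳ-≤ ((t + 1) * y) _ _ (begin
  (t + 1) * y + (t + 1) * y ≡⟨ a₁ ((t + 1) * y) ⟩
  2 * ((t + 1) * y) ≤⟨ *-monoʳ-≤ 2 (bernoulli t n) ⟩
  2 * (t ^ n * (t + 1) + n * y) ≡⟨ a₂ (t ^ n) t n y ⟩
  (t + 1) * (2 * t ^ n) + (2 * n) * y ≤⟨ +-monoʳ-≤ _ (*-monoˡ-≤ y h) ⟩
  (t + 1) * (2 * t ^ n) + (t + 1) * y ∎))
  where
  open ≤-Reasoning
  y = (t + 1) ^ n
  a₁ : ∀ z → z + z ≡ 2 * z
  a₁ = solve-∀
  a₂ : ∀ x t n y → 2 * (x * (t + 1) + n * y) ≡ (t + 1) * (2 * x) + (2 * n) * y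
  a₂ = solve-∀

*-^ : ∀ a b c → (a * b) ^ c ≡ a ^ c * b ^ c
*-^ a b zero = refl
*-^ a b (suc c) = trans (cong (a * b *_) (*-^ a b c)) (arith a b (a ^ c) (b ^ c))
  where
  arith : ∀ a b x y → a * b * (x * y) ≡ a * x * (b * y)
  arith = solve-∀

[t+1]^[n*c]≤2^c*t^[n*c] : ∀ t n c → 2 * n ≤ t + 1 → (t + 1) ^ (n * c) ≤ 2 ^ c * t ^ (n * c)
[t+1]^[n*c]≤2^c*t^[n*c] t n c h = begin
  (t + 1) ^ (n * c) ≡⟨ sym (^-*-assoc (t + 1) n c) ⟩
  ((t + 1) ^ n) ^ c ≤⟨ ^-monoˡ-≤ c ([t+1]^n≤2t^n t n h) ⟩
  (2 * t ^ n) ^ c ≡⟨ *-^ 2 (t ^ n) c ⟩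
  2 ^ c * (t ^ n) ^ c ≡⟨ cong (2 ^ c *_) (^-*-assoc t n c) ⟩
  2 ^ c * t ^ (n * c) ∎
  where open ≤-Reasoning

-- The pairs are chosen by the method of conditional expectations: the potential Φ weighs every
-- vertex set U of at most 2m elements by ρ^(V ∸ |U|) and by 2 to the number of pairs inside U.
module Potential (m σ : ℕ) (1≤m : 1 ≤ m) (1≤σ : 1 ≤ σ) where
  ρ V : ℕ
  ρ = 2 * σ
  V = ρ * m

  inside : Fin V × Fin V → Subset V → ℕ
  inside (u , v) U = [ u ∈? U ] * [ v ∈? U ]

  cnt : List (Fin V × Fin V) → Subset V → ℕ
  cnt [] U = 0
  cnt (e ∷ g) U = inside e U + cnt g U

  -- The power of `ρ` replaces estimates of binomial coefficients: the total weight is at most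
  -- `(ρ + 1) ^ V`, while a set of at most `2 * m` vertices weighs at least `ρ ^ (V ∸ 2 * m)`.
  weight : Subset V → ℕ
  weight U = [ ∣ U ∣ ≤? 2 * m ] * ρ ^ (V ∸ ∣ U ∣)

  Φ : List (Fin V × Fin V) → ℕ
  Φ g = Σˢ V (λ U → weight U * 2 ^ cnt g U)

  inside≤1 : ∀ e U → inside e U ≤ 1
  inside≤1 (u , v) U = *-mono-≤ ([]≤1 (u ∈? U)) ([]≤1 (v ∈? U))

  2^-inside : ∀ e U → 2 ^ inside e U ≡ 1 + inside e U
  2^-inside e U with inside e U | inside≤1 e U
  ... | 0 | _ = refl
  ... | 1 | _ = refl
  ... | suc (suc _) | s≤s ()

  sum-inside : ∀ U → sum (λ u → sum (λ v → 1 + inside (u , v) U)) ≡ V * V + ∣ U ∣ * ∣ U ∣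
  sum-inside U = trans (sum-cong (λ u → ∑-distrib-+ (λ v → 1) (λ v → inside (u , v) U)))
    (trans (∑-distrib-+ (λ u → sum (λ v → 1)) (λ u → sum (λ v → inside (u , v) U)))
      (cong₂ _+_ (trans (sum-cong (λ u → trans (sum-const V 1) (*-identityʳ V))) (sum-const V V))
        (trans (sum-cong (λ u → sym (*-distribˡ-sum [ u ∈? U ] (λ v → [ v ∈? U ]))))
          (trans (sym (*-distribʳ-sum (# (_∈? U)) (λ u → [ u ∈? U ]))) (cong₂ _*_ (sym (∣∣-sum U)) (sym (∣∣-sum U)))))))

  -- A pair inside `U` doubles the term of `U`, and this happens for `∣ U ∣ * ∣ U ∣` of the `V * V`
  -- pairs. Only sets with at most `2 * m` vertices carry weight.
  average : ∀ g → sum (λ u → sum (λ v → Φ ((u , v) ∷ g))) ≤ (V * V + (2 * m) * (2 * m)) * Φ g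
  average g = begin
    sum (λ u → sum (λ v → Φ ((u , v) ∷ g)))
      ≡⟨ sum-cong (λ u → sum-Σˢ V (λ v U → weight U * 2 ^ cnt ((u , v) ∷ g) U)) ⟩
    sum (λ u → Σˢ V (λ U → sum (λ v → weight U * 2 ^ cnt ((u , v) ∷ g) U)))
      ≡⟨ sum-Σˢ V (λ u U → sum (λ v → weight U * 2 ^ cnt ((u , v) ∷ g) U)) ⟩
    Σˢ V (λ U → sum (λ u → sum (λ v → weight U * 2 ^ cnt ((u , v) ∷ g) U)))
      ≤⟨ Σˢ-mono V term ⟩
    Σˢ V (λ U → c * (weight U * 2 ^ cnt g U))
      ≡⟨ sym (*-Σˢ V c _) ⟩
    c * Φ g ∎
    where
    open ≤-Reasoning
    c = V * V + (2 * m) * (2 * m)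
    rearrange : ∀ w x y → w * ((1 + x) * y) ≡ (w * y) * (1 + x)
    rearrange = solve-∀
    split : ∀ U u v → weight U * 2 ^ cnt ((u , v) ∷ g) U ≡ (weight U * 2 ^ cnt g U) * (1 + inside (u , v) U)
    split U u v = trans (cong (weight U *_) (trans (^-distribˡ-+-* 2 (inside (u , v) U) (cnt g U)) (cong (_* 2 ^ cnt g U) (2^-inside (u , v) U))))
      (rearrange (weight U) (inside (u , v) U) (2 ^ cnt g U))
    small : ∀ U z → (weight U * z) * (V * V + ∣ U ∣ * ∣ U ∣) ≤ c * (weight U * z)
    small U z = go (∣ U ∣ ≤? 2 * m)
      where
      X = ρ ^ (V ∸ ∣ U ∣)
      go : (d : Dec (∣ U ∣ ≤ 2 * m)) → ([ d ] * X * z) * (V * V + ∣ U ∣ * ∣ U ∣) ≤ c * ([ d ] * X * z)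
      go (yes h) = ≤-trans (*-monoʳ-≤ (1 * X * z) (+-monoʳ-≤ (V * V) (*-mono-≤ h h))) (≤-reflexive (*-comm (1 * X * z) c))
      go (no _) = z≤n
    term : ∀ U → sum (λ u → sum (λ v → weight U * 2 ^ cnt ((u , v) ∷ g) U)) ≤ c * (weight U * 2 ^ cnt g U)
    term U = ≤-trans (≤-reflexive (trans
        (sum-cong (λ u → trans (sum-cong (split U u)) (sym (*-distribˡ-sum (weight U * 2 ^ cnt g U) (λ v → 1 + inside (u , v) U)))))
        (trans (sym (*-distribˡ-sum (weight U * 2 ^ cnt g U) (λ u → sum (λ v → 1 + inside (u , v) U)))) (cong (weight U * 2 ^ cnt g U *_) (sum-inside U)))))
      (small U (2 ^ cnt g U))

  -- Since `V = 2 * σ * m`, the ratio `(2m)² / V²` is `1 / σ²`; some pair does no worse than the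
  -- average.
  extend : ∀ g → ∃ λ e → (σ * σ) * Φ (e ∷ g) ≤ (σ * σ + 1) * Φ g
  extend g with any? (λ u → any? (λ v → (σ * σ) * Φ ((u , v) ∷ g) ≤? (σ * σ + 1) * Φ g))
  ... | yes (u , v , h) = (u , v) , h
  -- If every pair failed, each would exceed the average by at least one, and there is at least one
  -- pair.
  ... | no none = contradiction too-small (<⇒≱ (≤-trans (s≤s (≤-reflexive (rearrange σ m (Φ g)))) (+-monoˡ-≤ (V * (V * Y)) 1≤VV)))
    where
    open ≤-Reasoning
    Y = (σ * σ + 1) * Φ g
    1≤VV : 1 ≤ V * V
    1≤VV = *-mono-≤ 1≤V 1≤V
      where
      1≤V : 1 ≤ V
      1≤V = *-mono-≤ (≤-trans 1≤σ (m≤m+n σ _)) 1≤m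
    rearrange : ∀ σ m z → (σ * σ) * ((2 * σ * m * (2 * σ * m) + 2 * m * (2 * m)) * z) ≡ 2 * σ * m * (2 * σ * m * ((σ * σ + 1) * z))
    rearrange = solve-∀
    large : ∀ u v → suc Y ≤ (σ * σ) * Φ ((u , v) ∷ g)
    large u v = ≰⇒> λ h → none (u , v , h)
    split : ∀ v y → v * (v * (1 + y)) ≡ v * v + v * (v * y)
    split = solve-∀
    too-small : V * V + V * (V * Y) ≤ (σ * σ) * ((V * V + (2 * m) * (2 * m)) * Φ g)
    too-small = begin
      V * V + V * (V * Y) ≡⟨ sym (split V Y) ⟩
      V * (V * suc Y) ≡⟨ sym (trans (sum-cong (λ u → sum-const V (suc Y))) (sum-const V (V * suc Y))) ⟩
      sum {V} (λ u → sum {V} (λ v → suc Y)) ≤⟨ sum-mono (λ u → sum-mono (large u)) ⟩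
      sum (λ u → sum (λ v → (σ * σ) * Φ ((u , v) ∷ g))) ≡⟨ sum-cong (λ u → sym (*-distribˡ-sum (σ * σ) (λ v → Φ ((u , v) ∷ g)))) ⟩
      sum (λ u → (σ * σ) * sum (λ v → Φ ((u , v) ∷ g))) ≡⟨ sym (*-distribˡ-sum (σ * σ) (λ u → sum (λ v → Φ ((u , v) ∷ g)))) ⟩
      (σ * σ) * sum (λ u → sum (λ v → Φ ((u , v) ∷ g))) ≤⟨ *-monoʳ-≤ (σ * σ) (average g) ⟩
      (σ * σ) * ((V * V + (2 * m) * (2 * m)) * Φ g) ∎

  greedy : ∀ n → ∃ λ g → length g ≡ n × (σ * σ) ^ n * Φ g ≤ (σ * σ + 1) ^ n * Φ []
  greedy zero = [] , refl , ≤-refl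
  greedy (suc n) with greedy n
  ... | g , e , h with extend g
  ... | x , h′ = x ∷ g , cong suc e , (begin
    (σ * σ) * (σ * σ) ^ n * Φ (x ∷ g) ≡⟨ a₁ (σ * σ) ((σ * σ) ^ n) (Φ (x ∷ g)) ⟩
    (σ * σ) ^ n * ((σ * σ) * Φ (x ∷ g)) ≤⟨ *-monoʳ-≤ ((σ * σ) ^ n) h′ ⟩
    (σ * σ) ^ n * ((σ * σ + 1) * Φ g) ≡⟨ a₂ ((σ * σ) ^ n) (σ * σ + 1) (Φ g) ⟩
    (σ * σ + 1) * ((σ * σ) ^ n * Φ g) ≤⟨ *-monoʳ-≤ (σ * σ + 1) h ⟩
    (σ * σ + 1) * ((σ * σ + 1) ^ n * Φ []) ≡⟨ sym (*-assoc (σ * σ + 1) ((σ * σ + 1) ^ n) (Φ [])) ⟩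
    (σ * σ + 1) * (σ * σ + 1) ^ n * Φ [] ∎)
    where
    open ≤-Reasoning
    a₁ : ∀ a b c → a * b * c ≡ b * (a * c)
    a₁ = solve-∀
    a₂ : ∀ a b c → a * (b * c) ≡ b * (a * c)
    a₂ = solve-∀

  Φ[]≤ : Φ [] ≤ (ρ + 1) ^ V
  Φ[]≤ = ≤-trans (Σˢ-mono V (λ U → ≤-trans (≤-reflexive (*-identityʳ _)) (≤-trans (*-monoˡ-≤ _ ([]≤1 (∣ U ∣ ≤? 2 * m))) (≤-reflexive (*-identityˡ _)))))
    (≤-reflexive (Σˢ-binomial V ρ))

  Φ≥ : ∀ g U → ∣ U ∣ ≤ 2 * m → ρ ^ (V ∸ 2 * m) * 2 ^ cnt g U ≤ Φ g
  Φ≥ g U h = ≤-trans (*-monoˡ-≤ (2 ^ cnt g U) (begin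
      ρ ^ (V ∸ 2 * m) ≤⟨ ^-monoʳ-≤ ρ {{>-nonZero (≤-trans 1≤σ (m≤m+n σ _))}} (∸-monoʳ-≤ V h) ⟩
      ρ ^ (V ∸ ∣ U ∣) ≡⟨ sym (*-identityˡ _) ⟩
      1 * ρ ^ (V ∸ ∣ U ∣) ≡⟨ cong (_* ρ ^ (V ∸ ∣ U ∣)) (sym ([]-yes (∣ U ∣ ≤? 2 * m) h)) ⟩
      weight U ∎))
    (term≤Σˢ (λ U → weight U * 2 ^ cnt g U) U)
    where open ≤-Reasoning

  -- Choosing `n` pairs at most doubles the potential, so `n * h` of them cost a factor `2 ^ h`. The
  -- initial potential is at most `2 ^ (2m) * ρ ^ V`. Dividing by the weight of a single set leaves
  -- `ρ ^ (2m)`, which is at most `2 ^ (b * 2m)`.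
  sparse : ∀ n h b → 2 * n ≤ σ * σ + 1 → ρ ≤ 2 ^ b →
    ∃ λ g → length g ≡ n * h × (∀ U → ∣ U ∣ ≤ 2 * m → cnt g U ≤ h + (2 * m + b * (2 * m)))
  sparse n h b n≤ ρ≤ with greedy (n * h)
  ... | g , e , H = g , e , λ U hU → ≮⇒≥ λ K<cnt → <⇒≱ (^-monoʳ-< 2 (s≤s (s≤s z≤n)) K<cnt) (bound U hU)
    where
    open ≤-Reasoning
    P = (σ * σ) ^ (n * h)
    Q = ρ ^ (V ∸ 2 * m)
    instance
      σ≢0 : NonZero σ
      σ≢0 = >-nonZero 1≤σ
      σσ≢0 : NonZero (σ * σ)
      σσ≢0 = m*n≢0 σ σ
      ρ≢0 : NonZero ρ
      ρ≢0 = >-nonZero (≤-trans 1≤σ (m≤m+n σ _))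
      P≢0 : NonZero P
      P≢0 = m^n≢0 (σ * σ) (n * h)
      Q≢0 : NonZero Q
      Q≢0 = m^n≢0 ρ (V ∸ 2 * m)
    2m≤V : 2 * m ≤ V
    2m≤V = *-monoˡ-≤ m (≤-trans (≤-reflexive (sym (*-identityʳ 2))) (*-monoʳ-≤ 2 1≤σ))
    ρ^V : ρ ^ V ≡ ρ ^ (2 * m) * Q
    ρ^V = trans (cong (ρ ^_) (sym (m+[n∸m]≡n 2m≤V))) (^-distribˡ-+-* ρ (2 * m) (V ∸ 2 * m))
    V≡ : V ≡ σ * (2 * m)
    V≡ = arith σ m
      where
      arith : ∀ σ m → 2 * σ * m ≡ σ * (2 * m)
      arith = solve-∀
    2^K : 2 ^ (h + (2 * m + b * (2 * m))) ≡ 2 ^ h * (2 ^ (2 * m) * (2 ^ b) ^ (2 * m))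
    2^K = trans (^-distribˡ-+-* 2 h _) (cong (2 ^ h *_) (trans (^-distribˡ-+-* 2 (2 * m) _) (cong (2 ^ (2 * m) *_) (sym (^-*-assoc 2 b (2 * m))))))
    bound : ∀ U → ∣ U ∣ ≤ 2 * m → 2 ^ cnt g U ≤ 2 ^ (h + (2 * m + b * (2 * m)))
    bound U hU = *-cancelˡ-≤ P (*-cancelˡ-≤ Q (begin
      Q * (P * 2 ^ cnt g U) ≡⟨ a₁ Q P (2 ^ cnt g U) ⟩
      P * (Q * 2 ^ cnt g U) ≤⟨ *-monoʳ-≤ P (Φ≥ g U hU) ⟩
      P * Φ g ≤⟨ H ⟩
      (σ * σ + 1) ^ (n * h) * Φ [] ≤⟨ *-mono-≤ ([t+1]^[n*c]≤2^c*t^[n*c] (σ * σ) n h n≤)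
          (≤-trans Φ[]≤ (≤-trans (≤-reflexive (cong ((ρ + 1) ^_) V≡)) ([t+1]^[n*c]≤2^c*t^[n*c] ρ σ (2 * m) (m≤m+n ρ 1)))) ⟩
      (2 ^ h * P) * (2 ^ (2 * m) * ρ ^ (σ * (2 * m))) ≡⟨ cong (λ z → (2 ^ h * P) * (2 ^ (2 * m) * z)) (trans (cong (ρ ^_) (sym V≡)) ρ^V) ⟩
      (2 ^ h * P) * (2 ^ (2 * m) * (ρ ^ (2 * m) * Q)) ≤⟨ *-monoʳ-≤ (2 ^ h * P) (*-monoʳ-≤ (2 ^ (2 * m)) (*-monoˡ-≤ Q (^-monoˡ-≤ (2 * m) ρ≤))) ⟩
      (2 ^ h * P) * (2 ^ (2 * m) * ((2 ^ b) ^ (2 * m) * Q)) ≡⟨ a₂ (2 ^ h) P (2 ^ (2 * m)) ((2 ^ b) ^ (2 * m)) Q ⟩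
      Q * (P * (2 ^ h * (2 ^ (2 * m) * (2 ^ b) ^ (2 * m)))) ≡⟨ cong (λ z → Q * (P * z)) (sym 2^K) ⟩
      Q * (P * 2 ^ (h + (2 * m + b * (2 * m)))) ∎))
      where
      a₁ : ∀ a b c → a * (b * c) ≡ b * (a * c)
      a₁ = solve-∀
      a₂ : ∀ a p b c q → (a * p) * (b * (c * q)) ≡ q * (p * (a * (b * c)))
      a₂ = solve-∀

-- The sparse host and the upper bound

fromList : ∀ {n} → List (Fin n) → Subset n
fromList xs = tabulate (λ v → does (v ∈ˡ? xs))

∈-fromList : ∀ {n} {xs : List (Fin n)} {v} → v ∈ˡ xs → v ∈ fromList xs
∈-fromList {xs = xs} = ∈-tabulate⁺ (_∈ˡ? xs)

∣fromList∣ : ∀ {n} (xs : List (Fin n)) → ∣ fromList xs ∣ ≤ length xs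
∣fromList∣ xs = ≤-trans (≤-reflexive (∣tabulate∣ (_∈ˡ? xs))) (#-∈ˡ xs)

-- Each pair gets a private block of its own. A colour without a path is covered by `ρ` bags of at
-- most `2 * m` vertices, each containing at most `K` pairs, so `r` such colours account for at most
-- `r * ρ * K` pairs, fewer than `p`.
module SparseHost (ℓ q r m ρ V K p : ℕ) (1≤ℓ : 1 ≤ ℓ) (1≤m : 1 ≤ m) (i₀ : Fin r) (V≡ : ρ * m ≡ V)
  (end₁ end₂ : Fin p → Fin V)
  (sparse : ∀ U → ∣ U ∣ ≤ 2 * m → # (λ j → (end₁ j ∈? U) ×-dec (end₂ j ∈? U)) ≤ K)
  (p-large : (r * ρ) * K < p) where

  Ts : List (Fin V × Fin V × Fin p)
  Ts = List.tabulate (λ j → end₁ j , end₂ j , j)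

  open Host ℓ q V p Ts

  module _ (c : Colouring r host) where
    open Coloured c

    -- Carried along in the adjacency `A`, so that a private block determines its pair up to
    -- orientation.
    Ends : Fin p → Fin V → Fin V → Set
    Ends j u v = (end₁ j ≡ u × end₂ j ≡ v) ⊎ (end₁ j ≡ v × end₂ j ≡ u)

    ends? : ∀ j u v → Dec (Ends j u v)
    ends? j u v = ((end₁ j ≟ u) ×-dec (end₂ j ≟ v)) ⊎-dec ((end₁ j ≟ v) ×-dec (end₂ j ≟ u))

    A : Fin r → Fin V → Fin V → Set
    A i u v = ∃ λ j → HasEdge i u v j × Ends j u v

    A? : ∀ i u v → Dec (A i u v)
    A? i u v = any? (λ j → hasEdge? i u v j ×-dec ends? j u v)

    A-sym : ∀ i {u v} → A i u v → A i v u
    A-sym i {u} {v} (j , h , e) = j , hasEdge-sym {i} {u} {v} {j} h , [ inj₂ , inj₁ ]′ e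

    colour : ∀ j → ∃ λ i → A i (end₁ j) (end₂ j) ⊎ end₁ j ≡ end₂ j
    colour j with end₁ j ≟ end₂ j
    -- A pair with equal ends is covered in every colour, so a default colour is assigned to it.
    ... | yes e = i₀ , inj₂ e
    ... | no ne with host-index {end₁ j} {end₂ j} {j} (∈ˡ-tabulate⁺ {f = λ j → end₁ j , end₂ j , j} j) ne
    ... | f , e = c f , inj₁ (j , (f , e , refl) , inj₁ (refl , refl))

    private module D i = DFS (A i) (A? i) (λ {u} {v} → A-sym i {u} {v}) m

    path⇒copy : ∀ i → D.Path i → MonoCopy r host c (path k ℓ m)
    path⇒copy i (u₀ ∷ S , e , uS , lS) = Embed.monoCopy 1≤m 1≤ℓ a j a-inj j-inj es c i (λ t t<m → proj₁ (spec t t<m))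
      where
      a : ℕ → Fin V
      a = nth u₀ (u₀ ∷ S)
      a-inj : ∀ {t t′} → t < suc m → t′ < suc m → a t ≡ a t′ → t ≡ t′
      a-inj {t} {t′} h h′ = nth-injective u₀ uS (subst (t <_) (sym e) h) (subst (t′ <_) (sym e) h′)
      step : ∀ t → t < m → A i (a t) (a (suc t))
      step t t<m = nth-linked u₀ lS (subst (suc t <_) (sym e) (s≤s t<m))
      j₀ : Fin p
      j₀ = fromℕ< (≤-trans (s≤s z≤n) p-large)
      j : ℕ → Fin p
      j t with t <? m
      ... | yes t<m = proj₁ (step t t<m)
      ... | no _ = j₀
      spec : ∀ t → t < m → HasEdge i (a t) (a (suc t)) (j t) × Ends (j t) (a t) (a (suc t))
      spec t t<m with t <? m
      ... | yes t<m′ = proj₂ (step t t<m′)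
      ... | no ¬p = contradiction t<m ¬p
      -- The vertices of the path are distinct, so a common private block fixes the step. Opposite
      -- orientations would give `t = t′ + 1` and `t + 1 = t′`.
      meet : ∀ {j t t′} → t < m → t′ < m → Ends j (a t) (a (suc t)) → Ends j (a t′) (a (suc t′)) → t ≡ t′
      meet h h′ (inj₁ (p₁ , _)) (inj₁ (p₁′ , _)) = a-inj (<-trans h ≤-refl) (<-trans h′ ≤-refl) (trans (sym p₁) p₁′)
      meet h h′ (inj₂ (_ , p₂)) (inj₂ (_ , p₂′)) = a-inj (<-trans h ≤-refl) (<-trans h′ ≤-refl) (trans (sym p₂) p₂′)
      meet h h′ (inj₁ (p₁ , p₂)) (inj₂ (p₁′ , p₂′)) = crossed
          (a-inj (<-trans h ≤-refl) (s≤s h′) (trans (sym p₁) p₁′)) (a-inj (s≤s h) (<-trans h′ ≤-refl) (trans (sym p₂) p₂′))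
        where
        crossed : ∀ {t t′} → t ≡ suc t′ → suc t ≡ t′ → t ≡ t′
        crossed refl ()
      meet h h′ (inj₂ (p₁ , p₂)) (inj₁ (p₁′ , p₂′)) = sym (crossed
          (a-inj (<-trans h′ ≤-refl) (s≤s h) (trans (sym p₁′) p₁)) (a-inj (s≤s h′) (<-trans h ≤-refl) (trans (sym p₂′) p₂)))
        where
        crossed : ∀ {t t′} → t ≡ suc t′ → suc t ≡ t′ → t ≡ t′
        crossed refl ()
      j-inj : ∀ {t t′} → t < m → t′ < m → j t ≡ j t′ → t ≡ t′
      j-inj {t} {t′} h h′ eq = meet h h′ (proj₂ (spec t h)) (subst (λ z → Ends z (a t′) (a (suc t′))) (sym eq) (proj₂ (spec t′ h′)))

    no-covers : ¬ (∀ i → D.Cover i m ρ [])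
    no-covers cov = <⇒≱ p-large (pigeonhole-≤ f fibre)
      where
      open module C i = D.Cover i (cov i)
      cell : ∀ j → ∃ λ c → end₁ j ∈ˡ bag (proj₁ (colour j)) c × end₂ j ∈ˡ bag (proj₁ (colour j)) c
      cell j with covers (proj₁ (colour j)) (proj₂ (colour j)) (λ ()) (λ ())
      ... | c , h₁ , h₂ , _ = c , h₁ , h₂
      f : Fin p → Fin (r * ρ)
      f j = combine (proj₁ (colour j)) (proj₁ (cell j))
      bagOf : Fin r × Fin ρ → Subset V
      bagOf (i , c) = fromList (bag i c)
      bagOf-f : ∀ j → bagOf (remQuot ρ (f j)) ≡ bagOf (proj₁ (colour j) , proj₁ (cell j))
      bagOf-f j = cong bagOf (remQuot-combine (proj₁ (colour j)) (proj₁ (cell j)))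
      fibre : ∀ y → # (λ j → f j ≟ y) ≤ K
      fibre y = ≤-trans (#-mono (λ j → f j ≟ y) (λ j → (end₁ j ∈? U) ×-dec (end₂ j ∈? U)) within)
        (sparse U (≤-trans (∣fromList∣ (bag (proj₁ y′) (proj₂ y′)))
          (≤-trans (bag-size (proj₁ y′) (proj₂ y′)) (≤-reflexive (cong (m +_) (sym (+-identityʳ m)))))))
        where
        y′ = remQuot ρ y
        U = bagOf y′
        within : ∀ j → f j ≡ y → end₁ j ∈ U × end₂ j ∈ U
        within j refl = subst (λ U → end₁ j ∈ U × end₂ j ∈ U) (sym (bagOf-f j))
          (∈-fromList {xs = bag (proj₁ (colour j)) (proj₁ (cell j))} (proj₁ (proj₂ (cell j))) , ∈-fromList {xs = bag (proj₁ (colour j)) (proj₁ (cell j))} (proj₂ (proj₂ (cell j))))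

    copy : MonoCopy r host c (path k ℓ m)
    copy with ∀⊎⇒ (λ i → D.dfs i m ρ V≡)
    ... | inj₁ (i , P) = path⇒copy i P
    ... | inj₂ cov = ⊥-elim (no-covers cov)

  sparse-host : Σ Hypergraph λ G → IsKGraph k G × Arrows G r (path k ℓ m) × ne G ≤ p
  sparse-host = host , host-kGraph , copy , ≤-trans ne-host (≤-reflexive (length-tabulate _))

module _ (m σ : ℕ) (1≤m : 1 ≤ m) (1≤σ : 1 ≤ σ) where
  open Potential m σ 1≤m 1≤σ

  #≡cnt : ∀ g U → # (λ j → (proj₁ (lookup g j) ∈? U) ×-dec (proj₂ (lookup g j) ∈? U)) ≡ cnt g U
  #≡cnt [] U = sum-zero _
  #≡cnt ((u , v) ∷ g) U = trans (sum-suc _) (cong₂ _+_ (and (u ∈? U) (v ∈? U)) (#≡cnt g U))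
    where
    and : ∀ {P Q : Set} (P? : Dec P) (Q? : Dec Q) → [ P? ×-dec Q? ] ≡ [ P? ] * [ Q? ]
    and (yes _) (yes _) = refl
    and (yes _) (no _) = refl
    and (no _) _ = refl

-- The induction follows the recursion of the logarithm, which halves its argument and rounds up.
n≤2^⌈log₂n⌉ : ∀ n → n ≤ 2 ^ ⌈log₂ n ⌉
n≤2^⌈log₂n⌉ n = go n (<-wellFounded n)
  where
  n≤2⌈n/2⌉ : ∀ n → n ≤ 2 * ⌈ n /2⌉
  n≤2⌈n/2⌉ n = begin
    n ≡⟨ sym (⌊n/2⌋+⌈n/2⌉≡n n) ⟩
    ⌊ n /2⌋ + ⌈ n /2⌉ ≤⟨ +-mono-≤ (⌊n/2⌋≤⌈n/2⌉ n) (m≤m+n ⌈ n /2⌉ 0) ⟩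
    2 * ⌈ n /2⌉ ∎
    where open ≤-Reasoning
  go : ∀ n (a : Acc _<_ n) → n ≤ 2 ^ ⌈log2⌉ n a
  go 0 _ = z≤n
  go 1 _ = ≤-refl
  go (suc (suc n)) (acc rs) = begin
    2 + n ≤⟨ +-monoʳ-≤ 2 (n≤2⌈n/2⌉ n) ⟩
    2 + 2 * ⌈ n /2⌉ ≡⟨ sym (*-distribˡ-+ 2 1 ⌈ n /2⌉) ⟩
    2 * suc ⌈ n /2⌉ ≤⟨ *-monoʳ-≤ 2 (go (suc ⌈ n /2⌉) (rs (⌈n/2⌉<n n))) ⟩
    2 * 2 ^ ⌈log2⌉ (suc ⌈ n /2⌉) (rs (⌈n/2⌉<n n)) ∎
    where open ≤-Reasoning

potential-host : ∀ ℓ q r m σ n b h → 1 ≤ ℓ → 1 ≤ m → 1 ≤ σ → Fin r →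
  2 * n ≤ σ * σ + 1 → 2 * σ ≤ 2 ^ b → (r * (2 * σ)) * (h + (2 * m + b * (2 * m))) < n * h →
  let k = ℓ + (q + ℓ) in
  Σ Hypergraph λ G → IsKGraph k G × Arrows G r (path k ℓ m) × ne G ≤ n * h
potential-host ℓ q r m σ n b h 1≤ℓ 1≤m 1≤σ i₀ n≤ ρ≤ large = result (sparse n h b n≤ ρ≤)
  where
  open Potential m σ 1≤m 1≤σ
  K = h + (2 * m + b * (2 * m))
  result : (∃ λ g → length g ≡ n * h × (∀ U → ∣ U ∣ ≤ 2 * m → cnt g U ≤ K)) →
    Σ Hypergraph λ G → IsKGraph (ℓ + (q + ℓ)) G × Arrows G r (path (ℓ + (q + ℓ)) ℓ m) × ne G ≤ n * h
  result (g , e , H) with SparseHost.sparse-host ℓ q r m ρ V K (length g) 1≤ℓ 1≤m i₀ refl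
        (λ j → proj₁ (lookup g j)) (λ j → proj₂ (lookup g j))
        (λ U hU → ≤-trans (≤-reflexive (#≡cnt m σ 1≤m 1≤σ g U)) (H U hU))
        (subst ((r * ρ) * K <_) (sym e) large)
  ... | G , kG , arr , ne≤ = G , kG , arr , ≤-trans ne≤ (≤-reflexive e)

-- For σ = 8r the potential bounds the pairs inside 2m vertices by K = h + (2 + 2b) m, where 16r ≤ 2^b;
-- h = (3 + 2b) m is chosen to make the number 32r² h of pairs exceed r · 16r · K.
upper-host : ∀ ℓ q r m → 1 ≤ ℓ → 1 ≤ m → 1 ≤ r →
  let k = ℓ + (q + ℓ) in
  Σ Hypergraph λ G → IsKGraph k G × Arrows G r (path k ℓ m) ×
    ne G ≤ 32 * (r * r) * ((11 + 2 * ⌈log₂ r ⌉) * m)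
upper-host ℓ q r m 1≤ℓ 1≤m 1≤r = potential-host ℓ q r m (8 * r) (32 * (r * r)) (4 + ⌈log₂ r ⌉) ((11 + 2 * ⌈log₂ r ⌉) * m)
    1≤ℓ 1≤m (≤-trans 1≤r (m≤m+n r (7 * r))) (fromℕ< 1≤r) (n≤ r) (ρ≤ r) (large r m ⌈log₂ r ⌉ 1≤r 1≤m)
  where
  open ≤-Reasoning
  n≤ : ∀ r → 2 * (32 * (r * r)) ≤ (8 * r) * (8 * r) + 1
  n≤ r = ≤-trans (≤-reflexive (arith r)) (m≤m+n _ 1)
    where
    arith : ∀ r → 2 * (32 * (r * r)) ≡ (8 * r) * (8 * r)
    arith = solve-∀
  ρ≤ : ∀ r → 2 * (8 * r) ≤ 2 ^ (4 + ⌈log₂ r ⌉)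
  ρ≤ r = begin
    2 * (8 * r) ≡⟨ sym (*-assoc 2 8 r) ⟩
    16 * r ≤⟨ *-monoʳ-≤ 16 (n≤2^⌈log₂n⌉ r) ⟩
    16 * 2 ^ ⌈log₂ r ⌉ ≡⟨ sym (^-distribˡ-+-* 2 4 ⌈log₂ r ⌉) ⟩
    2 ^ (4 + ⌈log₂ r ⌉) ∎
  large : ∀ r m L → 1 ≤ r → 1 ≤ m →
    (r * (2 * (8 * r))) * ((11 + 2 * L) * m + (2 * m + (4 + L) * (2 * m))) < 32 * (r * r) * ((11 + 2 * L) * m)
  large r m L 1≤r 1≤m = begin-strict
    (r * (2 * (8 * r))) * ((11 + 2 * L) * m + (2 * m + (4 + L) * (2 * m))) <⟨ m<m+n _ (*-mono-≤ {1} {16} (s≤s z≤n) (*-mono-≤ (*-mono-≤ 1≤r 1≤r) 1≤m)) ⟩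
    (r * (2 * (8 * r))) * ((11 + 2 * L) * m + (2 * m + (4 + L) * (2 * m))) + 16 * (r * r * m) ≡⟨ arith r m L ⟩
    32 * (r * r) * ((11 + 2 * L) * m) ∎
    where
    arith : ∀ r m L → (r * (2 * (8 * r))) * ((11 + 2 * L) * m + (2 * m + (4 + L) * (2 * m))) + 16 * (r * r * m) ≡ 32 * (r * r) * ((11 + 2 * L) * m)
    arith = solve-∀

-- Defective colourings and the lower bound

sum-select : ∀ {n} (e : Fin n) (h : Fin n → ℕ) → sum (λ f → [ f ≟ e ] * h f) ≡ h e
sum-select {n} e h = trans (sum-cong eq) (trans (sym (*-distribʳ-sum (h e) (λ f → [ f ≟ e ]))) (trans (cong (_* h e) (#-≟′ e)) (*-identityˡ (h e))))
  where
  eq : ∀ f → [ f ≟ e ] * h f ≡ [ f ≟ e ] * h e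
  eq f with f ≟ e
  ... | yes refl = refl
  ... | no _ = refl

-- Lovász's argument: an element with two related elements of its own colour moves to a colour found
-- at most once among its related elements. This lowers the number of monochromatic related pairs,
-- so the process ends.
module Defective {M} (R : Fin M → Fin M → Set) (R? : ∀ e f → Dec (R e f))
  (R-sym : ∀ {e f} → R e f → R f e) (R-irrefl : ∀ {e} → ¬ R e e)
  {a} (degree : ∀ e → # (R? e) < a * 2) where

  mono? : (c : Fin M → Fin a) → ∀ e f → Dec (R e f × c e ≡ c f)
  mono? c e f = R? e f ×-dec (c e ≟ c f)

  defect : (Fin M → Fin a) → Fin M → ℕ
  defect c e = # (mono? c e)

  energy : (Fin M → Fin a) → ℕ
  energy c = sum (defect c)

  -- Otherwise each of the `a` colours would occur at least twice, which the degree bound forbids.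
  free-colour : ∀ (c : Fin M → Fin a) e → ∃ λ y → # (λ f → R? e f ×-dec (c f ≟ y)) ≤ 1
  free-colour c e with any? (λ y → # (λ f → R? e f ×-dec (c f ≟ y)) ≤? 1)
  ... | yes p = p
  ... | no none = contradiction many (<⇒≱ (degree e))
    where
    split : ∀ f → sum (λ y → [ R? e f ×-dec (c f ≟ y) ]) ≡ [ R? e f ]
    split f with R? e f
    ... | no _ = trans (sum-const a 0) (*-zeroʳ a)
    ... | yes _ = #-≟ (c f)
    many : a * 2 ≤ # (R? e)
    many = begin
      a * 2 ≡⟨ sym (sum-const a 2) ⟩
      sum {a} (λ y → 2) ≤⟨ sum-mono (λ y → ≰⇒> (λ h → none (y , h))) ⟩
      sum (λ y → # (λ f → R? e f ×-dec (c f ≟ y))) ≡⟨ ∑-comm (λ y f → [ R? e f ×-dec (c f ≟ y) ]) ⟩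
      sum (λ f → sum (λ y → [ R? e f ×-dec (c f ≟ y) ])) ≡⟨ sum-cong split ⟩
      # (R? e) ∎
      where open ≤-Reasoning

  module Recolour (c : Fin M → Fin a) (e : Fin M) (bad : 2 ≤ defect c e) where
    y : Fin a
    y = proj₁ (free-colour c e)

    c′ : Fin M → Fin a
    c′ f with f ≟ e
    ... | yes _ = y
    ... | no _ = c f

    c′-e : c′ e ≡ y
    c′-e with e ≟ e
    ... | yes _ = refl
    ... | no ¬p = contradiction refl ¬p

    c′-≢ : ∀ {f} → f ≢ e → c′ f ≡ c f
    c′-≢ {f} f≢e with f ≟ e
    ... | yes p = contradiction p f≢e
    ... | no _ = refl

    new? : ∀ f → Dec (R e f × c f ≡ y)
    new? f = R? e f ×-dec (c f ≟ y)

    old new : Fin M → ℕ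
    old f = [ mono? c e f ]
    new f = [ new? f ]

    -- Only pairs containing `e` change. The old incidences at `e` are added on one side and the new
    -- ones on the other, so that the comparison holds pair by pair without subtraction.
    exchange : ∀ f g (f≟e : Dec (f ≡ e)) (g≟e : Dec (g ≡ e)) →
      [ mono? c′ f g ] + ([ f≟e ] * old g + [ g≟e ] * old f) ≤ [ mono? c f g ] + ([ f≟e ] * new g + [ g≟e ] * new f)
    exchange f g (yes refl) (yes refl) = ≤-trans (≤-reflexive (cong₂ (λ p q → p + (1 * q + 1 * q))
      ([]-no (mono? c′ f f) (R-irrefl ∘ proj₁)) ([]-no (mono? c f f) (R-irrefl ∘ proj₁)))) z≤n
    exchange f g (yes refl) (no g≢e) = ≤-reflexive (trans (cong (_+ (1 * old g + 0))
      ([]-cong (mono? c′ f g) (new? g)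
        (λ { (p , q) → p , trans (sym (c′-≢ g≢e)) (trans (sym q) c′-e) })
        (λ { (p , q) → p , trans c′-e (trans (sym q) (sym (c′-≢ g≢e))) })))
      (arith (new g) (old g)))
      where
      arith : ∀ a b → a + (1 * b + 0) ≡ b + (1 * a + 0)
      arith = solve-∀
    exchange f g (no f≢e) (yes refl) = ≤-reflexive (trans (cong (_+ (0 + 1 * old f))
      ([]-cong (mono? c′ f g) (new? f)
        (λ { (p , q) → R-sym p , trans (sym (c′-≢ f≢e)) (trans q c′-e) })
        (λ { (p , q) → R-sym p , trans (c′-≢ f≢e) (trans q (sym c′-e)) })))
      (trans (arith (new f) (old f)) (cong (_+ (0 + 1 * new f))
        ([]-cong (mono? c g f) (mono? c f g) (λ { (p , q) → R-sym p , sym q }) (λ { (p , q) → R-sym p , sym q })))))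
      where
      arith : ∀ a b → a + (0 + 1 * b) ≡ b + (0 + 1 * a)
      arith = solve-∀
    exchange f g (no f≢e) (no g≢e) = ≤-reflexive (cong (_+ 0) ([]-cong (mono? c′ f g) (mono? c f g)
        (λ { (p , q) → p , trans (sym (c′-≢ f≢e)) (trans q (c′-≢ g≢e)) })
        (λ { (p , q) → p , trans (c′-≢ f≢e) (trans q (sym (c′-≢ g≢e))) })))

    double : ∀ (X : Fin M → Fin M → ℕ) (h : Fin M → ℕ) →
      sum (λ f → sum (λ g → X f g + ([ f ≟ e ] * h g + [ g ≟ e ] * h f))) ≡ sum (λ f → sum (X f)) + (sum h + sum h)
    double X h = trans (sum-cong (λ f → trans (∑-distrib-+ (X f) (λ g → [ f ≟ e ] * h g + [ g ≟ e ] * h f))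
        (cong (sum (X f) +_) (trans (∑-distrib-+ (λ g → [ f ≟ e ] * h g) (λ g → [ g ≟ e ] * h f))
          (cong₂ _+_ (sym (*-distribˡ-sum [ f ≟ e ] h)) (sum-select e (λ _ → h f)))))))
      (trans (∑-distrib-+ (λ f → sum (X f)) (λ f → [ f ≟ e ] * sum h + h f))
        (cong (sum (λ f → sum (X f)) +_) (trans (∑-distrib-+ (λ f → [ f ≟ e ] * sum h) h) (cong (_+ sum h) (sum-select e (λ _ → sum h))))))

    decrease : energy c′ < energy c
    -- The energy counts ordered pairs, so each incidence at `e` enters twice: at least `2 + 2` is
    -- lost and at most `1 + 1` is gained.
    decrease = +-cancelʳ-< (2 + 2) (energy c′) (energy c) (begin-strict
      energy c′ + (2 + 2) ≤⟨ +-monoʳ-≤ (energy c′) (+-mono-≤ bad bad) ⟩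
      energy c′ + (sum old + sum old) ≡⟨ sym (double (λ f g → [ mono? c′ f g ]) old) ⟩
      _ ≤⟨ sum-mono (λ f → sum-mono (λ g → exchange f g (f ≟ e) (g ≟ e))) ⟩
      _ ≡⟨ double (λ f g → [ mono? c f g ]) new ⟩
      energy c + (sum new + sum new) ≤⟨ +-monoʳ-≤ (energy c) (+-mono-≤ few few) ⟩
      energy c + (1 + 1) <⟨ +-monoʳ-< (energy c) (s≤s (s≤s (s≤s z≤n))) ⟩
      energy c + (2 + 2) ∎)
      where
      open ≤-Reasoning
      few : sum new ≤ 1
      few = proj₂ (free-colour c e)

  descend : ∀ c → Acc _<_ (energy c) → ∃ λ c → ∀ e → defect c e ≤ 1
  descend c (acc rs) with any? (λ e → 2 ≤? defect c e)
  ... | no none = c , λ e → ≤-pred (≰⇒> (λ h → none (e , h)))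
  ... | yes (e , bad) = descend (Recolour.c′ c e bad) (rs (Recolour.decrease c e bad))

  defective-colouring : Fin a → ∃ λ c → ∀ e → defect c e ≤ 1
  defective-colouring y = descend (λ _ → y) (<-wellFounded _)

module MonoPath {k ℓ m r : ℕ} (1≤ℓ : 1 ≤ ℓ) (2ℓ≤k : 2 * ℓ ≤ k) (1≤m : 1 ≤ m)
  {G : Hypergraph} {c : Colouring r G} (copy : MonoCopy r G c (path k ℓ m)) where

  d : ℕ
  d = k ∸ ℓ

  ℓ≤k : ℓ ≤ k
  ℓ≤k = ≤-trans (m≤m+n ℓ _) 2ℓ≤k

  d<k : d < k
  d<k = ≤-trans (m<n+m d 1≤ℓ) (≤-reflexive (m+[n∸m]≡n ℓ≤k))

  ℓ≤d : ℓ ≤ d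
  ℓ≤d = ≤-trans (≤-reflexive (sym (m+n∸m≡n ℓ ℓ))) (∸-monoˡ-≤ ℓ (≤-trans (+-monoʳ-≤ ℓ (m≤m+n ℓ 0)) 2ℓ≤k))

  k≤2d : k ≤ d + d
  k≤2d = ≤-trans (≤-reflexive (sym (m+[n∸m]≡n ℓ≤k))) (+-monoˡ-≤ d ℓ≤d)

  φ : Fin (pathV k ℓ m) → Fin (nv G)
  φ = proj₁ copy

  φ-inj : Injective _≡_ _≡_ φ
  φ-inj = proj₁ (proj₂ copy)

  i : Fin r
  i = proj₁ (proj₂ (proj₂ copy))

  edgeAt : ∀ {t} → t < m → Σ (Fin (ne G)) λ f → (lookup (edges G) f ≡ image φ (pathEdge k ℓ m t)) × (c f ≡ i)
  edgeAt = applyUpTo⁻ id m (AllP.map⁻ (proj₂ (proj₂ (proj₂ copy))))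

  F : ℕ → Fin (ne G)
  F t with t <? m
  ... | yes t<m = proj₁ (edgeAt t<m)
  ... | no _ = proj₁ (edgeAt 1≤m)

  F-spec : ∀ {t} → t < m → (lookup (edges G) (F t) ≡ image φ (pathEdge k ℓ m t)) × (c (F t) ≡ i)
  F-spec {t} t<m with t <? m
  ... | yes t<m′ = proj₂ (edgeAt t<m′)
  ... | no ¬p = contradiction t<m ¬p

  _∈F_ : Fin (nv G) → ℕ → Set
  v ∈F t = v ∈ lookup (edges G) (F t)

  ∈F⁻ : ∀ {t v} → t < m → v ∈F t → ∃ λ x → φ x ≡ v × t * d ≤ toℕ x × toℕ x < t * d + k
  ∈F⁻ {t} {v} t<m h with ∈-image⁻ φ (subst (v ∈_) (proj₁ (F-spec t<m)) h)
  ... | x , x∈ , e = x , e , ∈-pathEdge⁻ {k} {ℓ} {m} {t} x∈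

  ∈F⁺ : ∀ {t} x → t < m → t * d ≤ toℕ x → toℕ x < t * d + k → φ x ∈F t
  ∈F⁺ {t} x t<m p q = subst (φ x ∈_) (sym (proj₁ (F-spec t<m))) (∈-image⁺ φ (∈-pathEdge⁺ {k} {ℓ} {m} {t} p q))

  -- From `2 * ℓ ≤ k` follows `k ≤ 2 * d`, so edge `t` ends before edge `t + 2` starts.
  far : ∀ {t t′ v} → t < m → t′ < m → 2 + t ≤ t′ → v ∈F t → v ∈F t′ → ⊥
  far {t} {t′} h h′ gap p q with ∈F⁻ h p | ∈F⁻ h′ q
  ... | x , refl , _ , hi | x′ , e , lo , _ with φ-inj e
  ... | refl = <⇒≱ hi (≤-trans (≤-trans (+-monoʳ-≤ (t * d) k≤2d)
        (≤-trans (≤-reflexive (trans (+-comm (t * d) (d + d)) (+-assoc d d (t * d)))) (*-monoˡ-≤ d gap))) lo)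

  td<n : ∀ {t} → t < m → t * d < pathV k ℓ m
  td<n {t} t<m = ≤-trans (m<n+m (t * d) (≤-trans 1≤ℓ ℓ≤k)) (+-monoʳ-≤ k (*-monoˡ-≤ d (∸-monoˡ-≤ 1 t<m)))

  -- The first position of edge `t`. Because `d < k`, it also lies on edge `t - 1` if there is one,
  -- and so witnesses that consecutive edges meet.
  x : ∀ {t} → t < m → Fin (pathV k ℓ m)
  x t<m = fromℕ< (td<n t<m)

  toℕ-x : ∀ {t} (h : t < m) → toℕ (x h) ≡ t * d
  toℕ-x h = toℕ-fromℕ< (td<n h)

  first∈ : ∀ {t} (h : t < m) → φ (x h) ∈F t
  first∈ {t} h = ∈F⁺ (x h) h (≤-reflexive (sym (toℕ-x h))) (≤-trans (s≤s (≤-reflexive (toℕ-x h))) (m<m+n (t * d) (≤-trans 1≤ℓ ℓ≤k)))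

  next∈ : ∀ {t} (h : suc t < m) → φ (x h) ∈F t
  next∈ {t} h = ∈F⁺ (x h) (<-trans ≤-refl h) (≤-trans (m≤n+m (t * d) d) (≤-reflexive (sym (toℕ-x h))))
    (≤-trans (s≤s (≤-reflexive (toℕ-x h))) (≤-trans (+-monoˡ-< (t * d) d<k) (≤-reflexive (+-comm k (t * d)))))

  F≢next : ∀ {t} → suc t < m → F t ≢ F (suc t)
  F≢next {t} h e with ∈F⁻ h (subst (λ f → φ (x h′) ∈ lookup (edges G) f) e (first∈ h′))
    where
    h′ : t < m
    h′ = <-trans ≤-refl h
  ... | y , e′ , lo , _ with φ-inj e′
  ... | refl = <⇒≱ (≤-trans (m<n+m (t * d) (≤-trans 1≤ℓ ℓ≤d)) lo) (≤-reflexive (toℕ-x (<-trans ≤-refl h)))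

  F≢next² : ∀ {t} → suc (suc t) < m → F t ≢ F (suc (suc t))
  F≢next² {t} h e = far (<-trans (n<1+n t) (<-trans ≤-refl h)) h ≤-refl (subst (λ f → φ (x h) ∈ lookup (edges G) f) (sym e) (first∈ h)) (first∈ h)

distinct-in-list : ∀ {n W} (w : Fin W → Fin n) → Injective _≡_ _≡_ w → ∀ xs → (∀ s → w s ∈ˡ xs) → W ≤ length xs
distinct-in-list w inj xs h = ≤-trans (≤-reflexive (sym (#-range w inj)))
  (≤-trans (#-mono (λ y → any? (λ o → w o ≟ y)) (_∈ˡ? xs) (λ { y (o , refl) → h o })) (#-∈ˡ xs))

-- Buckets and the removal of heavy vertices

module Buckets {k : ℕ} (r : ℕ) (G : Hypergraph) (kG : IsKGraph k G) (1≤k : 1 ≤ k) where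

  n M : ℕ
  n = nv G
  M = ne G

  e : Fin M → Subset n
  e = lookup (edges G)

  ∣e∣ : ∀ f → ∣ e f ∣ ≡ k
  ∣e∣ f = All.lookup (proj₂ kG) (∈-lookup f)

  Hits : List (Fin n) → Fin M → Set
  Hits xs f = ∃ λ v → v ∈ˡ xs × v ∈ e f

  hits? : ∀ xs f → Dec (Hits xs f)
  hits? xs f = any? (λ v → (v ∈ˡ? xs) ×-dec (v ∈? e f))

  Touched Rem : (Fin r → List (Fin n)) → Fin M → Set
  Touched B f = ∃ λ i → Hits (B i) f
  Rem B f = ¬ Touched B f

  touched? : ∀ B f → Dec (Touched B f)
  touched? B f = any? (λ i → hits? (B i) f)

  rem? : ∀ B f → Dec (Rem B f)
  rem? B f = ¬? (touched? B f)

  degree : (Fin r → List (Fin n)) → Fin n → ℕ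
  degree B v = # (λ f → rem? B f ×-dec (v ∈? e f))

  add : Fin r → Fin n → (Fin r → List (Fin n)) → Fin r → List (Fin n)
  add i v B j with j ≟ i
  ... | yes _ = v ∷ B j
  ... | no _ = B j

  add-≡ : ∀ i v B → add i v B i ≡ v ∷ B i
  add-≡ i v B with i ≟ i
  ... | yes _ = refl
  ... | no ¬p = contradiction refl ¬p

  add-≢ : ∀ {i v B j} → j ≢ i → add i v B j ≡ B j
  add-≢ {i} {v} {B} {j} j≢i with j ≟ i
  ... | yes p = contradiction p j≢i
  ... | no _ = refl

  ⊆-add : ∀ {i v B j u} → u ∈ˡ B j → u ∈ˡ add i v B j
  ⊆-add {i} {v} {B} {j} h with j ≟ i
  ... | yes _ = there h
  ... | no _ = h

  -- The remaining edges at `v` become touched, and no touched edge is released.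
  add-decreases : ∀ i v B → # (rem? (add i v B)) + degree B v ≤ # (rem? B)
  add-decreases i v B = #-split (rem? (add i v B)) (λ f → rem? B f ×-dec (v ∈? e f)) (rem? B)
    (λ f h (_ , v∈) → h (i , v , subst (v ∈ˡ_) (sym (add-≡ i v B)) (here refl) , v∈))
    (λ { f (inj₁ h) (j , u , u∈B , u∈f) → h (j , u , ⊆-add {i} {v} {B} {j} u∈B , u∈f) ; f (inj₂ (h , _)) → h })

  -- The hypothesis says that degrees are below `2a/k + 1`, cleared of the division. A remaining
  -- edge then meets fewer than `2a/k` others at each of its `k` vertices, so the intersection
  -- relation `R` has degree below `2a`.
  module Light (B : Fin r → List (Fin n)) (a : ℕ) (light : ∀ v → k * degree B v < 2 * a + k) where

    R : Fin M → Fin M → Set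
    R f g = (Rem B f × Rem B g) × (f ≢ g × ∃ λ v → v ∈ e f × v ∈ e g)

    R? : ∀ f g → Dec (R f g)
    R? f g = (rem? B f ×-dec rem? B g) ×-dec (¬? (f ≟ g) ×-dec any? (λ v → (v ∈? e f) ×-dec (v ∈? e g)))

    R-sym : ∀ {f g} → R f g → R g f
    R-sym ((p , q) , f≢g , v , v∈ , v∈′) = (q , p) , f≢g ∘ sym , v , v∈′ , v∈

    others? : ∀ f v g → Dec (Rem B g × v ∈ e g × g ≢ f)
    others? f v g = rem? B g ×-dec ((v ∈? e g) ×-dec ¬? (g ≟ f))

    others-bound : ∀ {f v} → Rem B f → v ∈ e f → # (others? f v) + 1 ≤ degree B v
    others-bound {f} {v} remf v∈ = ≤-trans (+-monoʳ-≤ (# (others? f v)) (≤-reflexive (sym (#-≟′ f))))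
      (#-split (others? f v) (_≟ f) (λ g → rem? B g ×-dec (v ∈? e g))
        (λ g (_ , _ , g≢f) g≡f → g≢f g≡f)
        (λ { g (inj₁ (p , q , _)) → p , q ; g (inj₂ refl) → remf , v∈ }))

    k*others : ∀ {f v} → Rem B f → v ∈ e f → k * # (others? f v) < 2 * a
    k*others {f} {v} remf v∈ = +-cancelʳ-< k _ _ (≤-trans (s≤s (≤-trans (≤-reflexive (arith k (# (others? f v))))
        (*-monoʳ-≤ k (others-bound remf v∈)))) (light v))
      where
      arith : ∀ k x → k * x + k ≡ k * (x + 1)
      arith = solve-∀

    vertex-of : ∀ f → ∃ λ v → v ∈ e f
    vertex-of f = #-pos (_∈? e f) (≤-trans 1≤k (≤-reflexive (trans (sym (∣e∣ f)) (∣∣-sum (e f)))))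

    a>0 : ∀ {f} → Rem B f → 1 ≤ a
    a>0 {f} remf with k*others remf (proj₂ (vertex-of f))
    ... | h = n≢0⇒n>0 λ { refl → contradiction h λ () }

    line-degree : ∀ {f} → Rem B f → # (R? f) < 2 * a
    line-degree {f} remf = ≰⇒> λ 2a≤ → <⇒≱ (too-many 2a≤) (≤-trans kdeg (≤-reflexive (*-comm k (2 * a ∸ 1))))
      where
      open ≤-Reasoning
      x : Fin n → ℕ
      x v = # (others? f v)
      -- Strictness is used at every vertex: `k` times the number of other edges there is at most
      -- `2a - 1`.
      kdeg : k * # (R? f) ≤ k * (2 * a ∸ 1)
      kdeg = begin
        k * # (R? f) ≤⟨ *-monoʳ-≤ k (sum-mono pointwise) ⟩
        k * sum (λ g → sum (λ v → [ v ∈? e f ] * [ others? f v g ])) ≡⟨ cong (k *_) (∑-comm (λ g v → [ v ∈? e f ] * [ others? f v g ])) ⟩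
        k * sum (λ v → sum (λ g → [ v ∈? e f ] * [ others? f v g ])) ≡⟨ cong (k *_) (sum-cong (λ v → sym (*-distribˡ-sum [ v ∈? e f ] (λ g → [ others? f v g ])))) ⟩
        k * sum (λ v → [ v ∈? e f ] * x v) ≡⟨ *-distribˡ-sum k (λ v → [ v ∈? e f ] * x v) ⟩
        sum (λ v → k * ([ v ∈? e f ] * x v)) ≤⟨ sum-mono (λ v → each v (v ∈? e f)) ⟩
        sum (λ v → [ v ∈? e f ] * (2 * a ∸ 1)) ≡⟨ sym (*-distribʳ-sum (2 * a ∸ 1) (λ v → [ v ∈? e f ])) ⟩
        # (_∈? e f) * (2 * a ∸ 1) ≡⟨ cong (_* (2 * a ∸ 1)) (trans (sym (∣∣-sum (e f))) (∣e∣ f)) ⟩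
        k * (2 * a ∸ 1) ∎
        where
        pointwise : ∀ g → [ R? f g ] ≤ sum (λ v → [ v ∈? e f ] * [ others? f v g ])
        pointwise g = go (R? f g)
          where
          go : (d : Dec (R f g)) → [ d ] ≤ sum (λ v → [ v ∈? e f ] * [ others? f v g ])
          go (no _) = z≤n
          go (yes ((_ , q) , f≢g , v , v∈ , v∈′)) = ≤-trans
            (≤-reflexive (sym (cong₂ _*_ ([]-yes (v ∈? e f) v∈) ([]-yes (others? f v g) (q , v∈′ , f≢g ∘ sym)))))
            (term≤sum (λ v → [ v ∈? e f ] * [ others? f v g ]) v)
        each : ∀ v (d : Dec (v ∈ e f)) → k * ([ d ] * x v) ≤ [ d ] * (2 * a ∸ 1)
        each v (no _) = ≤-reflexive (*-zeroʳ k)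
        each v (yes v∈) = ≤-trans (≤-reflexive (cong (k *_) (*-identityˡ (x v))))
          (≤-trans (∸-monoˡ-≤ 1 (k*others remf v∈)) (≤-reflexive (sym (*-identityˡ (2 * a ∸ 1)))))
      too-many : 2 * a ≤ # (R? f) → (2 * a ∸ 1) * k < k * # (R? f)
      too-many h = begin-strict
        (2 * a ∸ 1) * k <⟨ *-monoˡ-< k {{>-nonZero 1≤k}} (∸-monoʳ-< {2 * a} {1} {0} (s≤s z≤n) (≤-trans (a>0 remf) (m≤m+n a _))) ⟩
        2 * a * k ≡⟨ *-comm (2 * a) k ⟩
        k * (2 * a) ≤⟨ *-monoʳ-≤ k h ⟩
        k * # (R? f) ∎

two≤# : ∀ {n} {P : Fin n → Set} (P? : ∀ i → Dec (P i)) {x y} → x ≢ y → P x → P y → 2 ≤ # P?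
two≤# P? {x} {y} x≢y px py = ≤-trans (≤-reflexive (sym (cong₂ _+_ (#-≟′ x) (#-≟′ y))))
  (#-split (_≟ x) (_≟ y) P? (λ { i refl e → x≢y e }) (λ { i (inj₁ refl) → px ; i (inj₂ refl) → py }))

module HeavyVertex {k ℓ m r : ℕ} (1≤ℓ : 1 ≤ ℓ) (2ℓ≤k : 2 * ℓ ≤ k) (1≤m : 1 ≤ m) (1≤k : 1 ≤ k) (i₀ : Fin r)
  (μ : ℕ) (μ-small : 4 * μ + 3 ≤ m)
  (G : Hypergraph) (kG : IsKGraph k G) (arr : Arrows G r (path k ℓ m)) where
  open Buckets r G kG 1≤k

  -- Colours below `a` also colour the untouched edges. Each remaining colour appears only on edges
  -- that meet its bucket, and may therefore hold twice as many vertices.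
  record Valid (a : ℕ) (B : Fin r → List (Fin n)) : Set where
    field
      shared : ∀ {j} → toℕ j < a → length (B j) ≤ μ
      exclusive : ∀ j → length (B j) ≤ 2 * μ

  module _ {a B} (a≤r : a ≤ r) (valid : Valid a B) (light : ∀ v → k * degree B v < 2 * a + k) where
    open Valid valid
    open Light B a light

    Background : Set
    Background = ∃ λ (c : Fin M → Fin r) → (∀ f → Rem B f → toℕ (c f) < a) ×
      (∀ f → Rem B f → # (λ g → R? f g ×-dec (c f ≟ c g)) ≤ 1)

    background : Background
    background = go a refl
      where
      go : ∀ a′ → a′ ≡ a → Background
      -- With no background colour left, lightness forces every edge to be touched, and both
      -- conditions hold vacuously.
      go zero refl = (λ _ → i₀) , (λ _ remf → contradiction (a>0 remf) λ ()) , (λ _ remf → contradiction (a>0 remf) λ ())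
      go (suc _) refl = c′
          , (λ f _ → subst (_< a) (sym (toℕ-inject≤ (c f) a≤r)) (toℕ<n (c f)))
          , (λ f _ → ≤-trans (#-mono (λ g → R? f g ×-dec (c′ f ≟ c′ g)) (mono? c f)
              (λ { g (p , q) → p , inject≤-injective a≤r a≤r (c f) (c g) q })) (proj₂ cc f))
        where
        R-degree : ∀ f → # (R? f) < a * 2
        R-degree f with rem? B f
        ... | yes remf = subst (# (R? f) <_) (*-comm 2 a) (line-degree remf)
        ... | no ¬rem = subst (_< a * 2) (sym (#-none (R? f) (λ g ((p , _) , _) → ¬rem p))) (s≤s z≤n)
        R-irrefl : ∀ {f} → ¬ R f f
        R-irrefl (_ , f≢f , _) = f≢f refl
        open Defective R R? R-sym R-irrefl {a} R-degree
        cc = defective-colouring zero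
        c = proj₁ cc
        c′ : Fin M → Fin r
        c′ f = inject≤ (c f) a≤r

    c : Fin M → Fin r
    c = proj₁ background

    colouring : Colouring r G
    colouring f with touched? B f
    ... | yes (i , _) = i
    ... | no _ = c f

    status : ∀ {f i} → colouring f ≡ i → Hits (B i) f ⊎ (Rem B f × c f ≡ i)
    status {f} e with touched? B f
    status refl | yes (i , h) = inj₁ h
    status e | no remf = inj₂ (remf , e)

    open MonoPath 1≤ℓ 2ℓ≤k 1≤m {G = G} {c = colouring} (arr colouring)

    hit-or-rem : ∀ {t} → t < m → Hits (B i) (F t) ⊎ (Rem B (F t) × c (F t) ≡ i)
    hit-or-rem t<m = status (proj₂ (F-spec t<m))

    -- Window `s` ends two before the start of window `s + 1`, counted in edges; hence edges from
    -- different windows are disjoint and are hit by different bucket vertices.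
    Hit-in : ℕ → ℕ → Set
    Hit-in g s = ∃ λ t → g * s ≤ t × 2 + t ≤ g * suc s × t < m × Hits (B i) (F t)

    many-hits : ∀ g W → (∀ s → s < W → Hit-in g s) → W ≤ length (B i)
    many-hits g W hit = distinct-in-list w w-inj (B i) (λ s → proj₁ (proj₂ (proj₂ (proj₂ (proj₂ (proj₂ (hit (toℕ s) (toℕ<n s))))))))
      where
      w : Fin W → Fin n
      w s = proj₁ (proj₂ (proj₂ (proj₂ (proj₂ (hit (toℕ s) (toℕ<n s))))))
      clash : ∀ {s s′ : Fin W} → toℕ s < toℕ s′ → w s ≢ w s′
      clash {s} {s′} lt eq with hit (toℕ s) (toℕ<n s) | hit (toℕ s′) (toℕ<n s′)
      clash {s} {s′} lt refl | t , _ , hi , h , v , _ , v∈ | t′ , lo , _ , h′ , _ , _ , v∈′ =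
        far h h′ (≤-trans hi (≤-trans (*-monoʳ-≤ g lt) lo)) v∈ v∈′
      w-inj : Injective _≡_ _≡_ w
      w-inj {s} {s′} eq with <-cmp (toℕ s) (toℕ s′)
      ... | tri< lt _ _ = ⊥-elim (clash lt eq)
      ... | tri≈ _ e _ = toℕ-injective e
      ... | tri> _ _ gt = ⊥-elim (clash gt (sym eq))

    -- A colour outside the background comes only from its bucket, so every edge of the path is hit.
    -- The even-numbered edges `0, 2, ..., 4μ` suffice.
    exclusive-hit : a ≤ toℕ i → ∀ s → s < 1 + 2 * μ → Hit-in 2 s
    exclusive-hit a≤i s (s≤s s≤) = 2 * s , ≤-refl , ≤-reflexive (sym (*-suc 2 s)) , t<m , hit
      where
      t<m : 2 * s < m
      t<m = ≤-trans (s≤s (≤-trans (*-monoʳ-≤ 2 s≤) (≤-reflexive (arith μ)))) (≤-trans (m<m+n (4 * μ) (s≤s z≤n)) μ-small)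
        where
        arith : ∀ μ → 2 * (2 * μ) ≡ 4 * μ
        arith = solve-∀
      hit : Hits (B i) (F (2 * s))
      hit with hit-or-rem t<m
      ... | inj₁ h = h
      ... | inj₂ (remf , e) = contradiction (subst (λ j → toℕ j < a) e (proj₁ (proj₂ background) _ remf)) (≤⇒≯ a≤i)

    -- Three consecutive edges cannot all avoid the bucket: the middle one would meet two other
    -- remaining edges of its colour, against the defect bound. The last window uses edges `4μ` to
    -- `4μ + 2`, whence `4 * μ + 3 ≤ m`.
    shared-hit : ∀ s → s < 1 + μ → Hit-in 4 s
    shared-hit s (s≤s s≤) = hit
      where
      t₀ = 4 * s
      end : 2 + (2 + t₀) ≤ 4 * suc s
      end = ≤-reflexive (sym (*-suc 4 s))
      h₂ : suc (suc t₀) < m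
      h₂ = ≤-trans (≤-reflexive (+-comm 3 t₀)) (≤-trans (+-monoˡ-≤ 3 (*-monoʳ-≤ 4 s≤)) μ-small)
      h₁ : suc t₀ < m
      h₁ = <-trans ≤-refl h₂
      h₀ : t₀ < m
      h₀ = <-trans ≤-refl h₁
      hit : Hit-in 4 s
      hit with hit-or-rem h₀ | hit-or-rem h₁ | hit-or-rem h₂
      ... | inj₁ h | _ | _ = t₀ , ≤-refl , ≤-trans (m≤n+m (2 + t₀) 2) end , h₀ , h
      ... | _ | inj₁ h | _ = 1 + t₀ , n≤1+n t₀ , ≤-trans (m≤n+m (3 + t₀) 1) end , h₁ , h
      ... | _ | _ | inj₁ h = 2 + t₀ , m≤n+m t₀ 2 , end , h₂ , h
      ... | inj₂ (r₀ , e₀) | inj₂ (r₁ , e₁) | inj₂ (r₂ , e₂) =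
        contradiction (proj₂ (proj₂ background) _ r₁) (<⇒≱ (two≤# (λ g → R? (F (suc t₀)) g ×-dec (c (F (suc t₀)) ≟ c g)) (F≢next² h₂)
          (((r₁ , r₀) , F≢next h₁ ∘ sym , φ (x h₁) , first∈ h₁ , next∈ h₁) , trans e₁ (sym e₀))
          (((r₁ , r₂) , F≢next h₂ , φ (x h₂) , next∈ h₂ , first∈ h₂) , trans e₁ (sym e₂))))

    absurd : ⊥
    absurd with toℕ i <? a
    ... | yes i<a = <⇒≱ (n<1+n μ) (≤-trans (many-hits 4 (1 + μ) shared-hit) (shared i<a))
    ... | no i≮a = <⇒≱ (n<1+n (2 * μ)) (≤-trans (many-hits 2 (1 + 2 * μ) (exclusive-hit (≮⇒≥ i≮a))) (exclusive i))

  heavy : ∀ {a B} → a ≤ r → Valid a B → ∃ λ v → 2 * a + k ≤ k * degree B v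
  heavy {a} {B} a≤r valid with any? (λ v → 2 * a + k ≤? k * degree B v)
  ... | yes p = p
  ... | no none = ⊥-elim (absurd a≤r valid (λ v → ≰⇒> (λ h → none (v , h))))

  -- Scaled by `k`, so that moving a vertex of degree at least `2a/k + 1` lowers it by at least
  -- `2a`.
  remaining : (Fin r → List (Fin n)) → ℕ
  remaining B = k * # (rem? B)

  Filled : ℕ → Fin r → ℕ → (Fin r → List (Fin n)) → Set
  Filled a i t B = ∃ λ B′ → Valid a B′ × (∀ j → j ≢ i → B′ j ≡ B j) × remaining B′ + t * (2 * a) ≤ remaining B

  fill : ∀ {a} i t B → a ≤ r → Valid a B → length (B i) + t ≤ 2 * μ → (toℕ i < a → length (B i) + t ≤ μ) → Filled a i t B
  fill i zero B a≤r valid h h′ = B , valid , (λ _ _ → refl) , ≤-reflexive (+-identityʳ _)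
  fill {a} i (suc t) B a≤r valid h h′ with heavy a≤r valid
  ... | v , hv = result (fill i t B₁ a≤r valid₁ (subst (_≤ 2 * μ) size₁ h) (λ i<a → subst (_≤ μ) size₁ (h′ i<a)))
    where
    open Valid
    B₁ = add i v B
    len : length (B₁ i) ≡ suc (length (B i))
    len = cong length (add-≡ i v B)
    size₁ : length (B i) + suc t ≡ length (B₁ i) + t
    size₁ = trans (+-suc (length (B i)) t) (cong (_+ t) (sym len))
    fits : ∀ {x} → length (B i) + suc t ≤ x → length (B₁ i) ≤ x
    fits le = ≤-trans (m≤m+n _ t) (≤-trans (≤-reflexive (sym size₁)) le)
    valid₁ : Valid a B₁
    valid₁ .shared {j} j<a with j ≟ i
    ... | yes refl = subst (λ z → length z ≤ μ) (add-≡ i v B) (fits (h′ j<a))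
    ... | no _ = shared valid j<a
    valid₁ .exclusive j with j ≟ i
    ... | yes refl = subst (λ z → length z ≤ 2 * μ) (add-≡ i v B) (fits h)
    ... | no _ = exclusive valid j
    result : Filled a i t B₁ → Filled a i (suc t) B
    result (B′ , valid′ , other , dec) = B′ , valid′
      , (λ j j≢i → trans (other j j≢i) (add-≢ {i} {v} {B} j≢i))
      , (begin
          remaining B′ + (2 * a + t * (2 * a)) ≡⟨ arith (remaining B′) (2 * a) (t * (2 * a)) ⟩
          (remaining B′ + t * (2 * a)) + 2 * a ≤⟨ +-mono-≤ dec (≤-trans (m≤m+n (2 * a) k) hv) ⟩
          k * # (rem? B₁) + k * degree B v ≡⟨ sym (*-distribˡ-+ k (# (rem? B₁)) (degree B v)) ⟩
          k * (# (rem? B₁) + degree B v) ≤⟨ *-monoʳ-≤ k (add-decreases i v B) ⟩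
          remaining B ∎)
      where
      open ≤-Reasoning
      arith : ∀ x y z → x + (y + z) ≡ (x + z) + y
      arith = solve-∀

  -- All `r` colours stay in the background, so each of the `s * μ` vertices moved so far accounts
  -- for `2 * r`.
  First : ℕ → Set
  First s = ∃ λ B → (∀ j → length (B j) ≤ μ) × (∀ j → s ≤ toℕ j → B j ≡ []) ×
    remaining B + s * (μ * (2 * r)) ≤ k * M

  first-phase : ∀ s → s ≤ r → First s
  first-phase zero _ = (λ _ → []) , (λ _ → z≤n) , (λ _ _ → refl) , ≤-trans (≤-reflexive (+-identityʳ _)) (*-monoʳ-≤ k (#≤n (rem? (λ _ → []))))
  first-phase (suc s) s<r with first-phase s (≤-trans (n≤1+n s) s<r)
  ... | B , small , empty , dec = result (fill i μ B ≤-refl (record { shared = λ _ → small _ ; exclusive = λ j → ≤-trans (small j) (m≤m+n μ _) })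
          (≤-trans room (m≤m+n μ _)) (λ _ → room))
    where
    i : Fin r
    i = fromℕ< s<r
    toℕ-i : toℕ i ≡ s
    toℕ-i = toℕ-fromℕ< s<r
    room : length (B i) + μ ≤ μ
    room = ≤-reflexive (cong (λ z → length z + μ) (empty i (≤-reflexive (sym toℕ-i))))
    result : Filled r i μ B → First (suc s)
    result (B′ , valid′ , other , dec′) = B′ , small′ , empty′ , (begin
        remaining B′ + (μ * (2 * r) + s * (μ * (2 * r))) ≡⟨ sym (+-assoc (remaining B′) _ _) ⟩
        (remaining B′ + μ * (2 * r)) + s * (μ * (2 * r)) ≤⟨ +-monoˡ-≤ _ dec′ ⟩
        remaining B + s * (μ * (2 * r)) ≤⟨ dec ⟩
        k * M ∎)
      where
      open ≤-Reasoning
      small′ : ∀ j → length (B′ j) ≤ μ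
      small′ j = Valid.shared valid′ (toℕ<n j)
      empty′ : ∀ j → suc s ≤ toℕ j → B′ j ≡ []
      empty′ j s<j = trans (other j (λ { refl → <⇒≢ s<j (sym toℕ-i) })) (empty j (≤-trans (n≤1+n s) s<j))

  -- Colours are withdrawn from the background one at a time, each receiving μ further vertices;
  -- both sides carry extra terms so that no subtraction occurs.
  Second : ℕ → Set
  Second a = ∃ λ B → Valid a B × remaining B + μ * (3 * (r * r) + a) ≤ k * M + μ * (r + a * a)

  -- Withdrawing the colours `r - 1` down to `a` contributes `μ` times the sum of their doubles,
  -- `r(r-1) - a(a-1)`. Together with `2μr²` from the first phase this is the invariant.
  second-phase : ∀ b a → b + a ≡ r → Second a
  second-phase zero a refl with first-phase r ≤-refl
  ... | B , small , _ , dec = B , record { shared = λ _ → small _ ; exclusive = λ j → ≤-trans (small j) (m≤m+n μ _) } , (begin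
      remaining B + μ * (3 * (r * r) + r) ≡⟨ arith (remaining B) μ r ⟩
      (remaining B + r * (μ * (2 * r))) + μ * (r + r * r) ≤⟨ +-monoˡ-≤ _ dec ⟩
      k * M + μ * (r + r * r) ∎)
    where
    open ≤-Reasoning
    arith : ∀ x μ r → x + μ * (3 * (r * r) + r) ≡ (x + r * (μ * (2 * r))) + μ * (r + r * r)
    arith = solve-∀
  second-phase (suc b) a e with second-phase b (suc a) (trans (+-suc b a) e)
  -- Colour `a` has just left the background, so its bucket may grow from `μ` to `2 * μ`.
  ... | B , valid , dec = result (fill i μ B (<⇒≤ a<r)
          (record { shared = λ j<a → Valid.shared valid (≤-trans j<a (n≤1+n a)) ; exclusive = Valid.exclusive valid })
          (≤-trans (+-monoˡ-≤ μ (Valid.shared valid (≤-reflexive (cong suc toℕ-i)))) (+-monoʳ-≤ μ (m≤m+n μ 0))) (λ i<a → contradiction (subst (_< a) toℕ-i i<a) (<-irrefl refl)))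
    where
    a<r : a < r
    a<r = ≤-trans (s≤s (m≤n+m a b)) (≤-reflexive e)
    i : Fin r
    i = fromℕ< a<r
    toℕ-i : toℕ i ≡ a
    toℕ-i = toℕ-fromℕ< a<r
    result : Filled a i μ B → Second a
    result (B′ , valid′ , _ , dec′) = B′ , valid′ , +-cancelʳ-≤ (μ * (1 + 2 * a)) _ _ (begin
        remaining B′ + μ * (3 * (r * r) + a) + μ * (1 + 2 * a) ≡⟨ a₁ (remaining B′) μ (3 * (r * r)) a ⟩
        (remaining B′ + μ * (2 * a)) + μ * (3 * (r * r) + suc a) ≤⟨ +-monoˡ-≤ _ dec′ ⟩
        remaining B + μ * (3 * (r * r) + suc a) ≤⟨ dec ⟩
        k * M + μ * (r + suc a * suc a) ≡⟨ a₂ (k * M) μ r a ⟩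
        k * M + μ * (r + a * a) + μ * (1 + 2 * a) ∎)
      where
      open ≤-Reasoning
      a₁ : ∀ x μ y a → x + μ * (y + a) + μ * (1 + 2 * a) ≡ (x + μ * (2 * a)) + μ * (y + (1 + a))
      a₁ = solve-∀
      a₂ : ∀ x μ r a → x + μ * (r + (1 + a) * (1 + a)) ≡ x + μ * (r + a * a) + μ * (1 + 2 * a)
      a₂ = solve-∀

  lower-bound : μ * (3 * (r * r)) ≤ k * ne G + μ * r
  lower-bound with second-phase r 0 (+-identityʳ r)
  ... | B , _ , dec = begin
      μ * (3 * (r * r)) ≤⟨ *-monoʳ-≤ μ (m≤m+n (3 * (r * r)) 0) ⟩
      μ * (3 * (r * r) + 0) ≤⟨ m≤n+m _ (remaining B) ⟩
      remaining B + μ * (3 * (r * r) + 0) ≤⟨ dec ⟩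
      k * M + μ * (r + 0) ≡⟨ cong (λ z → k * M + μ * z) (+-identityʳ r) ⟩
      k * M + μ * r ∎
    where open ≤-Reasoning

-- Existence of the size-Ramsey number

-- Functions are searched through their finite codes, which recover them only pointwise; hence the
-- requirement that `P` respects pointwise equality.
any-function? : ∀ {a b} {P : (Fin a → Fin b) → Set} → (∀ {f g} → (∀ x → f x ≡ g x) → P f → P g) →
  (∀ f → Dec (P f)) → Dec (∃ P)
any-function? resp P? = map′ (λ (i , p) → finToFun i , p) (λ (f , p) → funToFin f , resp (λ x → sym (finToFun-funToFin f x)) p)
  (any? (λ i → P? (finToFun i)))

image-cong : ∀ {a b} {φ ψ : Fin a → Fin b} → (∀ x → φ x ≡ ψ x) → ∀ e → image φ e ≡ image ψ e
image-cong {φ = φ} {ψ} h e = ⊆-antisym (sub φ ψ h) (sub ψ φ (sym ∘ h))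
  where
  sub : ∀ φ ψ → (∀ x → φ x ≡ ψ x) → image φ e ⊆ image ψ e
  sub φ ψ h x∈ with ∈-image⁻ φ x∈
  ... | v , v∈ , refl = subst (_∈ image ψ e) (sym (h v)) (∈-image⁺ ψ v∈)

injective? : ∀ {a b} (φ : Fin a → Fin b) → Dec (Injective _≡_ _≡_ φ)
injective? φ = map′ (λ h {x} {y} → h x y) (λ h x y → h)
  (all? (λ x → all? (λ y → (φ x ≟ φ y) →-dec (x ≟ y))))

monoCopy? : ∀ r G c H → Dec (MonoCopy r G c H)
monoCopy? r G c H = any-function? resp λ φ → injective? φ ×-dec any? λ i →
    All.all? (λ e → any? λ f → (lookup (edges G) f ≟ˢ image φ e) ×-dec (c f ≟ i)) (edges H)
  where
  resp : ∀ {φ ψ : Fin (nv H) → Fin (nv G)} → (∀ x → φ x ≡ ψ x) → _ → _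
  resp h (inj , i , all) = (λ {x} {y} e → inj (trans (h x) (trans e (sym (h y)))))
    , i , All.map (λ {e} (f , p , q) → f , trans p (image-cong h e) , q) all

arrows? : ∀ G r H → Dec (Arrows G r H)
arrows? G r H = map′ (λ none c → decidable-stable (monoCopy? r G c H) (λ ¬p → none (c , ¬p)))
    (λ arr (c , ¬p) → ¬p (arr c))
    (¬? (any-function? resp (λ c → ¬? (monoCopy? r G c H))))
  where
  resp : ∀ {c c′ : Colouring r G} → (∀ f → c f ≡ c′ f) → ¬ MonoCopy r G c H → ¬ MonoCopy r G c′ H
  resp h ¬p (φ , inj , i , all) = ¬p (φ , inj , i , All.map (λ (f , p , q) → f , p , trans (h f) q) all)

kGraph? : ∀ k G → Dec (IsKGraph k G)
kGraph? k G = unique? (edges G) ×-dec All.all? (λ e → ∣ e ∣ ≟ℕ k) (edges G)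
  where open import Data.List.Relation.Unary.Unique.DecPropositional _≟ˢ_ using (unique?)

any-list? : ∀ {n} M {P : List (Subset n) → Set} → (∀ es → Dec (P es)) → Dec (∃ λ es → length es ≡ M × P es)
any-list? zero P? = map′ (λ p → [] , refl , p) (λ { ([] , _ , p) → p }) (P? [])
any-list? (suc M) P? = map′ (λ { (e , es , h , p) → e ∷ es , cong suc h , p }) (λ { (e ∷ es , h , p) → e , es , suc-injective h , p })
  (anySubset? (λ e → any-list? M (λ es → P? (e ∷ es))))

module Delete {n} (v : Fin (suc n)) where

  shrink : Subset (suc n) → Subset n
  shrink e = tabulate (λ x → does (punchIn v x ∈? e))

  ∈-shrink⁺ : ∀ {e x} → punchIn v x ∈ e → x ∈ shrink e
  ∈-shrink⁺ {e} = ∈-tabulate⁺ (λ x → punchIn v x ∈? e)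

  ∈-shrink⁻ : ∀ {e x} → x ∈ shrink e → punchIn v x ∈ e
  ∈-shrink⁻ {e} = ∈-tabulate⁻ (λ x → punchIn v x ∈? e)

  ∣shrink∣ : ∀ {e} → v ∉ e → ∣ shrink e ∣ ≡ ∣ e ∣
  ∣shrink∣ {e} v∉ = trans (∣tabulate∣ (λ x → punchIn v x ∈? e)) (sym (trans (∣∣-sum e)
    (trans (sum-remove (λ x → [ x ∈? e ]) v) (cong (_+ # (λ x → punchIn v x ∈? e)) ([]-no (v ∈? e) v∉)))))

  shrink-injective : ∀ {e e′} → v ∉ e → v ∉ e′ → shrink e ≡ shrink e′ → e ≡ e′
  shrink-injective {e} {e′} v∉ v∉′ eq = ⊆-antisym (sub v∉ eq) (sub v∉′ (sym eq))
    where
    sub : ∀ {e e′} → v ∉ e → shrink e ≡ shrink e′ → e ⊆ e′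
    sub {e} {e′} v∉ eq {x} x∈ = subst (_∈ e′) (punchIn-punchOut v≢x)
        (∈-shrink⁻ (subst (punchOut v≢x ∈_) eq (∈-shrink⁺ (subst (_∈ e) (sym (punchIn-punchOut v≢x)) x∈))))
      where
      v≢x : v ≢ x
      v≢x refl = v∉ x∈

  unique-shrink : ∀ {es} → All (v ∉_) es → Unique es → Unique (map shrink es)
  unique-shrink [] [] = []
  unique-shrink (v∉ ∷ vs) (e≢ ∷ u) = AllP.map⁺ (All.zipWith (λ (v∉′ , e≢e′) eq → e≢e′ (shrink-injective v∉ v∉′ eq)) (vs , e≢)) ∷ unique-shrink vs u

  position : ∀ (es : List (Subset (suc n))) → Fin (length es) → Fin (length (map shrink es))
  position (e ∷ es) zero = zero
  position (e ∷ es) (suc f) = suc (position es f)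

  lookup-position : ∀ es f → lookup (map shrink es) (position es f) ≡ shrink (lookup es f)
  lookup-position (e ∷ es) zero = refl
  lookup-position (e ∷ es) (suc f) = lookup-position es f

  kGraph-shrink : ∀ {k es} → All (v ∉_) es → IsKGraph k (hg (suc n) es) → IsKGraph k (hg n (map shrink es))
  kGraph-shrink vs (u , sizes) = unique-shrink vs u , AllP.map⁺ (All.zipWith (λ (v∉ , size) → trans (∣shrink∣ v∉) size) (vs , sizes))

  -- Every vertex of `H` lies on an edge, so every vertex of a copy of `H` does too and the copy
  -- avoids the isolated vertex `v`.
  arrows-shrink : ∀ {es r H} → (∀ w → ∃ λ e → e ∈ˡ edges H × w ∈ e) → All (v ∉_) es →
    Arrows (hg (suc n) es) r H → Arrows (hg n (map shrink es)) r H
  arrows-shrink {es} {r} {H} spanned vs arr c with arr (c ∘ position es)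
  ... | φ , inj , i , all = φ′ , (λ e → inj (punchOut-injective (v≢φ _) (v≢φ _) e)) , i
      , All.map (λ {e} (f , p , q) → position es f , trans (lookup-position es f) (trans (cong shrink p) (shrink-image e)) , q) all
    where
    v≢φ : ∀ w → v ≢ φ w
    v≢φ w refl with spanned w
    ... | e , e∈ , w∈ with All.lookup all e∈
    ... | f , p , _ = All.lookup vs (∈-lookup f) (subst (φ w ∈_) (sym p) (∈-image⁺ φ w∈))
    φ′ : Fin (nv H) → Fin n
    φ′ w = punchOut (v≢φ w)
    shrink-image : ∀ e → shrink (image φ e) ≡ image φ′ e
    shrink-image e = ⊆-antisym to from
      where
      to : shrink (image φ e) ⊆ image φ′ e
      to {x} h with ∈-image⁻ φ (∈-shrink⁻ h)
      ... | w , w∈ , eq = subst (_∈ image φ′ e) (punchIn-injective v _ _ (trans (punchIn-punchOut (v≢φ w)) eq)) (∈-image⁺ φ′ w∈)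
      from : image φ′ e ⊆ shrink (image φ e)
      from h with ∈-image⁻ φ′ h
      ... | w , w∈ , refl = ∈-shrink⁺ (subst (_∈ image φ e) (sym (punchIn-punchOut (v≢φ w))) (∈-image⁺ φ w∈))

-- The edges have `ne G * k` incidences in all, too few to reach every vertex.
isolated : ∀ {k} G → IsKGraph k G → ne G * k < nv G → ∃ λ v → All (v ∉_) (edges G)
isolated {k} G (_ , sizes) h with any? (λ v → All.all? (λ e → ¬? (v ∈? e)) (edges G))
... | yes p = p
... | no none = contradiction (begin
    nv G ≡⟨ sym (trans (sum-const (nv G) 1) (*-identityʳ (nv G))) ⟩
    sum {nv G} (λ v → 1) ≤⟨ sum-mono covered ⟩
    sum (λ v → sum (λ f → [ v ∈? lookup (edges G) f ])) ≡⟨ ∑-comm (λ v f → [ v ∈? lookup (edges G) f ]) ⟩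
    sum (λ f → # (_∈? lookup (edges G) f)) ≡⟨ sum-cong (λ f → trans (sym (∣∣-sum (lookup (edges G) f))) (All.lookup sizes (∈-lookup f))) ⟩
    sum {ne G} (λ f → k) ≡⟨ sum-const (ne G) k ⟩
    ne G * k ∎) (<⇒≱ h)
  where
  open ≤-Reasoning
  covered : ∀ v → 1 ≤ sum (λ f → [ v ∈? lookup (edges G) f ])
  covered v with any? (λ f → v ∈? lookup (edges G) f)
  ... | yes (f , v∈) = ≤-trans (≤-reflexive (sym ([]-yes (v ∈? lookup (edges G) f) v∈))) (term≤sum (λ f → [ v ∈? lookup (edges G) f ]) f)
  ... | no v∉ = contradiction (v , All.tabulate (λ {e} e∈ v∈ → v∉ (index e∈ , subst (v ∈_) (lookup-index e∈) v∈))) none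

module Minimum (k r : ℕ) (H : Hypergraph) (spanned : ∀ w → ∃ λ e → e ∈ˡ edges H × w ∈ e) where

  Good : ℕ → ℕ → Set
  Good M n = ∃ λ es → length es ≡ M × IsKGraph k (hg n es) × Arrows (hg n es) r H

  good? : ∀ M n → Dec (Good M n)
  good? M n = any-list? M (λ es → kGraph? k (hg n es) ×-dec arrows? (hg n es) r H)

  -- More than `M * k` vertices would include an isolated one, which can be deleted. This bound
  -- makes the search for a host with `M` edges finite.
  Small : ℕ → Set
  Small M = ∃ λ (n : Fin (suc (M * k))) → Good M (toℕ n)

  small? : ∀ M → Dec (Small M)
  small? M = any? (λ n → good? M (toℕ n))

  small : ∀ {M} n → Good M n → Small M
  small {M} n good with n ≤? M * k
  ... | yes n≤ = fromℕ< (s≤s n≤) , subst (Good M) (sym (toℕ-fromℕ< (s≤s n≤))) good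
  small zero good | no n≰ = contradiction z≤n n≰
  small (suc n) (es , refl , kG , arr) | no n≰ with isolated (hg (suc n) es) kG (≰⇒> n≰)
  ... | v , vs = small n (map shrink es , length-map shrink es , kGraph-shrink vs kG , arrows-shrink {es} {r} {H} spanned vs arr)
    where open Delete v

  least : ∀ M → (∃ λ M′ → M′ ≤ M × Small M′ × (∀ {M″} → M″ < M′ → ¬ Small M″)) ⊎ (∀ {M″} → M″ < suc M → ¬ Small M″)
  least M with small? 0
  least zero | yes p = inj₁ (0 , z≤n , p , λ ())
  least zero | no ¬p = inj₂ λ { {zero} _ → ¬p ; {suc _} (s≤s ()) }
  least (suc M) | _ with least M
  ... | inj₁ (M′ , h , p , min) = inj₁ (M′ , ≤-trans h (n≤1+n M) , p , min)
  ... | inj₂ none with small? (suc M)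
  ... | yes p = inj₁ (suc M , ≤-refl , p , none)
  ... | no ¬p = inj₂ λ h s → [ (λ lt → none lt s) , (λ { refl → ¬p s }) ]′ (m≤n⇒m<n∨m≡n (≤-pred h))

  sizeRamseyNum : ∀ G → IsKGraph k G → Arrows G r H → ∃ λ M → IsSizeRamseyNum k r H M × M ≤ ne G
  sizeRamseyNum G kG arr with least (ne G)
  ... | inj₂ none = contradiction (small (nv G) (edges G , refl , kG , arr)) (none ≤-refl)
  ... | inj₁ (M , M≤ , (n , es , e , kG′ , arr′) , min) = M
      , ((hg (toℕ n) es , kG′ , arr′ , e) , λ G′ kG″ arr″ → ≮⇒≥ λ lt → min lt (small (nv G′) (edges G′ , refl , kG″ , arr″))) , M≤

-- Spanned paths and the final estimates

path-spanned : ∀ k ℓ m → 1 ≤ ℓ → 2 * ℓ ≤ k → 1 ≤ m → ∀ w → ∃ λ e → e ∈ˡ edges (path k ℓ m) × w ∈ e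
path-spanned k ℓ (suc m) 1≤ℓ 2ℓ≤k _ w with toℕ w <? m * d
  where d = k ∸ ℓ
... | no w≮ = pathEdge k ℓ (suc m) m , ∈-map⁺ (pathEdge k ℓ (suc m)) (∈-upTo⁺ ≤-refl)
    , ∈-pathEdge⁺ {k} {ℓ} {suc m} {m} (≮⇒≥ w≮) (≤-trans (toℕ<n w) (≤-reflexive (+-comm k (m * (k ∸ ℓ)))))
... | yes w< = pathEdge k ℓ (suc m) t , ∈-map⁺ (pathEdge k ℓ (suc m)) (∈-upTo⁺ t<)
    , ∈-pathEdge⁺ {k} {ℓ} {suc m} {t} (≤-trans (m≤n+m (t * d) (toℕ w % d)) (≤-reflexive (sym w≡)))
      (≤-trans (s≤s (≤-reflexive w≡)) (≤-trans (+-monoˡ-≤ (t * d) (≤-trans (m%n<n (toℕ w) d) (m∸n≤m k ℓ))) (≤-reflexive (+-comm k (t * d)))))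
  where
  d = k ∸ ℓ
  1≤d : 1 ≤ d
  1≤d = ≤-trans 1≤ℓ (≤-trans (≤-reflexive (sym (m+n∸m≡n ℓ ℓ))) (∸-monoˡ-≤ ℓ (≤-trans (+-monoʳ-≤ ℓ (m≤m+n ℓ 0)) 2ℓ≤k)))
  instance
    d≢0 : NonZero d
    d≢0 = >-nonZero 1≤d
  t = toℕ w / d
  w≡ : toℕ w ≡ toℕ w % d + t * d
  w≡ = m≡m%n+[m/n]*n (toℕ w) d
  t< : t < suc m
  t< = ≤-trans (*-cancelʳ-< d t m (≤-trans (s≤s (≤-trans (m≤n+m (t * d) (toℕ w % d)) (≤-reflexive (sym w≡)))) w<)) (n≤1+n m)

quarter : ∀ m → 3 ≤ m → ∃ λ μ → 4 * μ + 3 ≤ m × m ≤ 4 * μ + 6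
quarter m 3≤m = μ , subst (4 * μ + 3 ≤_) (sym m≡) (+-monoˡ-≤ 3 (m≤n+m (4 * μ) ρ))
    , subst (_≤ 4 * μ + 6) (sym m≡) (≤-trans (+-monoˡ-≤ 3 (+-monoˡ-≤ (4 * μ) (≤-pred (m%n<n (m ∸ 3) 4)))) (≤-reflexive (arith (4 * μ))))
  where
  μ = (m ∸ 3) / 4
  ρ = (m ∸ 3) % 4
  m≡ : m ≡ ρ + 4 * μ + 3
  m≡ = trans (sym (m∸n+n≡m 3≤m)) (cong (_+ 3) (trans (m≡m%n+[m/n]*n (m ∸ 3) 4) (cong (ρ +_) (*-comm μ 4))))
  arith : ∀ x → 3 + x + 3 ≡ x + 6
  arith = solve-∀

split-k : ∀ k ℓ → 2 * ℓ ≤ k → ∃ λ q → k ≡ ℓ + (q + ℓ)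
split-k k ℓ h = k ∸ 2 * ℓ , trans (sym (m+[n∸m]≡n h)) (arith ℓ (k ∸ 2 * ℓ))
  where
  arith : ∀ ℓ q → 2 * ℓ + q ≡ ℓ + (q + ℓ)
  arith = solve-∀

ramsey-upper : ∀ k ℓ s m N → 1 ≤ ℓ → 2 * ℓ ≤ k → 1 ≤ m → IsRamseyNum k s (path k ℓ m) N → N ≤ k * (1 + s * (1 + m))
ramsey-upper k ℓ s m N 1≤ℓ 2ℓ≤k 1≤m (_ , min) with split-k k ℓ 2ℓ≤k
... | q , refl with DenseHost.dense-host ℓ q s m x p 1≤ℓ 1≤m (n≤1+n _) ≤-refl zero (suc zero) (λ ()) zero
  where
  -- The summand 2 also provides two distinct vertices when `s = 0`.
  x = 2 + s * (2 * (1 + m))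
  p = 1 + s * m
... | G , kG , arr , refl = ≤-trans (min G kG arr)
    -- Raising the vertex count by `s * q` makes it a multiple of `k = 2ℓ + q`.
    (≤-trans (m≤m+n _ (s * q)) (≤-reflexive (arith ℓ q s m)))
  where
  arith : ∀ ℓ q s m → (2 + s * (2 * (1 + m))) * ℓ + (1 + s * m) * q + s * q ≡ (ℓ + (q + ℓ)) * (1 + s * (1 + m))
  arith = solve-∀

size-lower : ∀ {k ℓ r m μ} → 1 ≤ ℓ → 2 * ℓ ≤ k → 1 ≤ m → 1 ≤ r → 4 * μ + 3 ≤ m →
  ∀ G → IsKGraph k G → Arrows G r (path k ℓ m) → μ * (3 * (r * r)) ≤ k * ne G + μ * r
size-lower {r = suc r} {μ = μ} 1≤ℓ 2ℓ≤k 1≤m 1≤r μ≤ G kG arr =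
  HeavyVertex.lower-bound 1≤ℓ 2ℓ≤k 1≤m (≤-trans 1≤ℓ (≤-trans (m≤m+n _ _) 2ℓ≤k)) zero μ μ≤ G kG arr

-- By the lower bound on `k * ne G`, it suffices that `1 + s(1+m) + μ ≤ 3μr`. As `s ≤ 2(r-1)/3` and
-- `m` is about `4μ`, the leading terms are `8μr/3` and `3μr`; the length of the path makes `μ`
-- large enough to absorb the rest.
ramsey-vs-size : ∀ {k ℓ m} r → 2 ≤ r → 1 ≤ ℓ → 2 * ℓ ≤ k → 1 ≤ m → 12 * (r * r) < m →
  ∀ {M N} → IsSizeRamseyNum k r (path k ℓ m) M → IsRamseyNum k ((2 * r ∸ 2) / 3) (path k ℓ m) N →
  r * N ≤ (k * k) * M
ramsey-vs-size {k} {ℓ} {m} r@(suc r′) 2≤r 1≤ℓ 2ℓ≤k 1≤m m-large {N = N} ((G , kG , arr , refl) , _) ramsey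
  with quarter m (≤-trans (*-mono-≤ {3} {12} {1} {r * r} (s≤s (s≤s (s≤s z≤n))) (s≤s z≤n)) (<⇒≤ m-large))
... | μ , lo , hi = begin
  r * N ≤⟨ *-monoʳ-≤ r (ramsey-upper k ℓ s m N 1≤ℓ 2ℓ≤k 1≤m ramsey) ⟩
  r * (k * (1 + s * (1 + m))) ≡⟨ a₁ r k (1 + s * (1 + m)) ⟩
  k * (r * (1 + s * (1 + m))) ≤⟨ *-monoʳ-≤ k enough ⟩
  k * (k * ne G) ≡⟨ sym (*-assoc k k (ne G)) ⟩
  (k * k) * ne G ∎
  where
  open ≤-Reasoning
  s : ℕ
  s = (2 * r ∸ 2) / 3
  a₁ : ∀ r k x → r * (k * x) ≡ k * (r * x)
  a₁ = solve-∀
  3s≤2r′ : s * 3 ≤ 2 * r′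
  3s≤2r′ = ≤-trans (m/n*n≤m (2 * r ∸ 2) 3) (≤-reflexive (trans (cong (_∸ 2) (*-suc 2 r′)) (m+n∸m≡n 2 (2 * r′))))
  μ-large : 1 + 6 * r′ ≤ μ
  μ-large = *-cancelˡ-≤ 4 (+-cancelʳ-≤ 6 _ _ (≤-trans (≤-trans (≤-trans (m≤m+n _ (3 + 12 * (r′ * r′))) (≤-reflexive (arith r′))) m-large) hi))
    where
    arith : ∀ r → 4 * (1 + 6 * r) + 6 + (3 + 12 * (r * r)) ≡ 1 + 12 * ((1 + r) * (1 + r))
    arith = solve-∀
  key : 1 + s * (1 + m) + μ ≤ 3 * (μ * r)
  key = *-cancelˡ-≤ 3 (begin
    3 * (1 + s * (1 + m) + μ) ≤⟨ *-monoʳ-≤ 3 (+-monoˡ-≤ μ (+-monoʳ-≤ 1 (*-monoʳ-≤ s (+-monoʳ-≤ 1 hi)))) ⟩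
    3 * (1 + s * (1 + (4 * μ + 6)) + μ) ≡⟨ b₁ s μ ⟩
    s * 3 * (4 * μ + 7) + (3 + 3 * μ) ≤⟨ +-monoˡ-≤ _ (*-monoˡ-≤ (4 * μ + 7) 3s≤2r′) ⟩
    -- The padding completes the terms free of `μ`, namely `14r′ + 3`, to `6(1 + 6r′)`, which
    -- `μ-large` bounds by `6μ`.
    2 * r′ * (4 * μ + 7) + (3 + 3 * μ) ≤⟨ m≤m+n _ (3 + 22 * r′) ⟩
    2 * r′ * (4 * μ + 7) + (3 + 3 * μ) + (3 + 22 * r′) ≡⟨ b₂ r′ μ ⟩
    6 * (1 + 6 * r′) + (3 * μ + 8 * (r′ * μ)) ≤⟨ +-monoˡ-≤ _ (*-monoʳ-≤ 6 μ-large) ⟩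
    6 * μ + (3 * μ + 8 * (r′ * μ)) ≤⟨ m≤m+n _ (r′ * μ) ⟩
    6 * μ + (3 * μ + 8 * (r′ * μ)) + r′ * μ ≡⟨ b₃ r′ μ ⟩
    3 * (3 * (μ * r)) ∎)
    where
    b₁ : ∀ s μ → 3 * (1 + s * (1 + (4 * μ + 6)) + μ) ≡ s * 3 * (4 * μ + 7) + (3 + 3 * μ)
    b₁ = solve-∀
    b₂ : ∀ r μ → 2 * r * (4 * μ + 7) + (3 + 3 * μ) + (3 + 22 * r) ≡ 6 * (1 + 6 * r) + (3 * μ + 8 * (r * μ))
    b₂ = solve-∀
    b₃ : ∀ r μ → 6 * μ + (3 * μ + 8 * (r * μ)) + r * μ ≡ 3 * (3 * (μ * (1 + r)))
    b₃ = solve-∀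
  enough : r * (1 + s * (1 + m)) ≤ k * ne G
  enough = +-cancelʳ-≤ (μ * r) _ _ (begin
    r * (1 + s * (1 + m)) + μ * r ≡⟨ c₁ r (1 + s * (1 + m)) μ ⟩
    r * (1 + s * (1 + m) + μ) ≤⟨ *-monoʳ-≤ r key ⟩
    r * (3 * (μ * r)) ≡⟨ c₂ r μ ⟩
    μ * (3 * (r * r)) ≤⟨ size-lower {μ = μ} 1≤ℓ 2ℓ≤k 1≤m (s≤s z≤n) lo G kG arr ⟩
    k * ne G + μ * r ∎)
    where
    c₁ : ∀ r x μ → r * x + μ * r ≡ r * (x + μ)
    c₁ = solve-∀
    c₂ : ∀ r μ → r * (3 * (μ * r)) ≡ μ * (3 * (r * r))
    c₂ = solve-∀

-- A path with `m` edges has `ℓ + m(k - ℓ)` vertices, so a bound on vertices becomes one on edges.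
long-path : ∀ {k ℓ m} x → 1 ≤ ℓ → 2 * ℓ ≤ k → 1 ≤ m → x * (k ∸ ℓ) + ℓ < pathV k ℓ m → x < m
long-path {k} {ℓ} {m} x 1≤ℓ 2ℓ≤k 1≤m h = *-cancelʳ-< (k ∸ ℓ) x m (+-cancelʳ-< ℓ _ _
  (subst (x * (k ∸ ℓ) + ℓ <_) (trans (pathV≡ k ℓ m (≤-trans (m≤m+n ℓ _) 2ℓ≤k) 1≤m) (+-comm ℓ _)) h))

module _ {k ℓ m} (1≤ℓ : 1 ≤ ℓ) (2ℓ≤k : 2 * ℓ ≤ k) (1≤m : 1 ≤ m) where
  private
    ℓ≤k : ℓ ≤ k
    ℓ≤k = ≤-trans (m≤m+n ℓ _) 2ℓ≤k

  pathV≤km : pathV k ℓ m ≤ k * m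
  pathV≤km = begin
    pathV k ℓ m ≡⟨ pathV≡ k ℓ m ℓ≤k 1≤m ⟩
    ℓ + m * (k ∸ ℓ) ≤⟨ +-monoˡ-≤ _ (≤-trans (≤-reflexive (sym (*-identityˡ ℓ))) (*-monoˡ-≤ ℓ 1≤m)) ⟩
    m * ℓ + m * (k ∸ ℓ) ≡⟨ sym (*-distribˡ-+ m ℓ (k ∸ ℓ)) ⟩
    m * (ℓ + (k ∸ ℓ)) ≡⟨ cong (m *_) (m+[n∸m]≡n ℓ≤k) ⟩
    m * k ≡⟨ *-comm m k ⟩
    k * m ∎
    where open ≤-Reasoning

  m≤pathV : m ≤ pathV k ℓ m
  m≤pathV = begin
    m ≡⟨ sym (*-identityʳ m) ⟩
    m * 1 ≤⟨ *-monoʳ-≤ m 1≤d ⟩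
    m * (k ∸ ℓ) ≤⟨ m≤n+m _ ℓ ⟩
    ℓ + m * (k ∸ ℓ) ≡⟨ sym (pathV≡ k ℓ m ℓ≤k 1≤m) ⟩
    pathV k ℓ m ∎
    where
    open ≤-Reasoning
    1≤d : 1 ≤ k ∸ ℓ
    1≤d = ≤-trans 1≤ℓ (≤-trans (≤-reflexive (sym (m+n∸m≡n ℓ ℓ))) (∸-monoˡ-≤ ℓ (≤-trans (+-monoʳ-≤ ℓ (m≤m+n ℓ 0)) 2ℓ≤k)))

  -- Seven edges give `μ ≥ 1`, so the number of vertices is at most `km ≤ 10kμ`. From
  -- `3r² - r ≥ 2r²` follows `2μr² ≤ k * ne G`, and the two combine to the factor `5k²`.
  size-lower-quadratic : ∀ {r} → 1 ≤ r → 7 ≤ m → ∀ G → IsKGraph k G → Arrows G r (path k ℓ m) →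
    r * r * pathV k ℓ m ≤ 5 * (k * k) * ne G
  size-lower-quadratic {r} 1≤r 7≤m G kG arr with quarter m (≤-trans (s≤s (s≤s (s≤s z≤n))) 7≤m)
  ... | μ , lo , hi = begin
    r * r * pathV k ℓ m ≤⟨ *-monoʳ-≤ (r * r) pathV≤km ⟩
    r * r * (k * m) ≤⟨ *-monoʳ-≤ (r * r) (*-monoʳ-≤ k m≤10μ) ⟩
    r * r * (k * (10 * μ)) ≡⟨ a₁ r k μ ⟩
    5 * k * (2 * (μ * (r * r))) ≤⟨ *-monoʳ-≤ (5 * k) two ⟩
    5 * k * (k * ne G) ≡⟨ a₂ k (ne G) ⟩
    5 * (k * k) * ne G ∎
    where
    open ≤-Reasoning
    a₁ : ∀ r k μ → r * r * (k * (10 * μ)) ≡ 5 * k * (2 * (μ * (r * r)))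
    a₁ = solve-∀
    a₂ : ∀ k M → 5 * k * (k * M) ≡ 5 * (k * k) * M
    a₂ = solve-∀
    1≤μ : 1 ≤ μ
    1≤μ = n≢0⇒n>0 λ { refl → <⇒≱ (≤-trans 7≤m hi) ≤-refl }
    m≤10μ : m ≤ 10 * μ
    m≤10μ = ≤-trans hi (≤-trans (+-monoʳ-≤ (4 * μ) (*-monoʳ-≤ 6 1≤μ)) (≤-reflexive (sym (*-distribʳ-+ μ 4 6))))
    two : 2 * (μ * (r * r)) ≤ k * ne G
    two = +-cancelʳ-≤ (μ * (r * r)) _ _ (begin
      2 * (μ * (r * r)) + μ * (r * r) ≡⟨ b₁ μ (r * r) ⟩
      μ * (3 * (r * r)) ≤⟨ size-lower {μ = μ} 1≤ℓ 2ℓ≤k 1≤m 1≤r lo G kG arr ⟩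
      k * ne G + μ * r ≤⟨ +-monoʳ-≤ _ (*-monoʳ-≤ μ (≤-trans (≤-reflexive (sym (*-identityˡ r))) (*-monoˡ-≤ r 1≤r))) ⟩
      k * ne G + μ * (r * r) ∎)
      where
      b₁ : ∀ μ x → 2 * (μ * x) + μ * x ≡ μ * (3 * x)
      b₁ = solve-∀

  size-bounds : ∀ {r} → 2 ≤ r → 7 * k ≤ pathV k ℓ m → Σ ℕ λ M → IsSizeRamseyNum k r (path k ℓ m) M ×
    (r * r * pathV k ℓ m ≤ 5 * (k * k) * M) × (M ≤ 416 * (r * r * ⌈log₂ r ⌉) * pathV k ℓ m)
  size-bounds {r} 2≤r n-large with host
    where
    L = ⌈log₂ r ⌉
    host : Σ Hypergraph λ G → IsKGraph k G × Arrows G r (path k ℓ m) × ne G ≤ 32 * (r * r) * ((11 + 2 * L) * m)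
    host with split-k k ℓ 2ℓ≤k
    ... | q , refl = upper-host ℓ q r m 1≤ℓ 1≤m (≤-trans (s≤s z≤n) 2≤r)
  ... | G , kG , arr , few with Minimum.sizeRamseyNum k r (path k ℓ m) (path-spanned k ℓ m 1≤ℓ 2ℓ≤k 1≤m) G kG arr
  ... | M , isMin@((G′ , kG′ , arr′ , refl) , _) , M≤ = M , isMin
      , size-lower-quadratic (≤-trans (s≤s z≤n) 2≤r) 7≤m G′ kG′ arr′
      , (begin
          M ≤⟨ ≤-trans M≤ few ⟩
          -- For `r ≥ 2` the logarithm is at least 1 and absorbs the constant 11; the factor becomes
          -- `32 * 13 = 416`.
          32 * (r * r) * ((11 + 2 * L) * m) ≤⟨ *-monoʳ-≤ (32 * (r * r)) (*-mono-≤ 11+2L≤13L m≤pathV) ⟩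
          32 * (r * r) * (13 * L * pathV k ℓ m) ≡⟨ arith (r * r) L (pathV k ℓ m) ⟩
          416 * (r * r * L) * pathV k ℓ m ∎)
    where
    open ≤-Reasoning
    L = ⌈log₂ r ⌉
    arith : ∀ x L n → 32 * x * (13 * L * n) ≡ 416 * (x * L) * n
    arith = solve-∀
    11+2L≤13L : 11 + 2 * L ≤ 13 * L
    11+2L≤13L = ≤-trans (+-monoˡ-≤ (2 * L) (*-monoʳ-≤ 11 (⌈log₂⌉-mono-≤ 2≤r))) (≤-reflexive (sym (*-distribʳ-+ L 11 2)))
    7≤m : 7 ≤ m
    7≤m = *-cancelʳ-≤ 7 m k {{>-nonZero (≤-trans 1≤ℓ ℓ≤k)}} (≤-trans n-large (≤-trans pathV≤km (≤-reflexive (*-comm k m))))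

theorem1p7 : (k : ℕ) → 2 ≤ k →
    ((r ℓ m : ℕ) → 2 ≤ r → 1 ≤ ℓ → 2 * ℓ ≤ k → 1 ≤ m →
    12 * (r * r) * (k ∸ ℓ) + ℓ < pathV k ℓ m →
    (M N : ℕ) → IsSizeRamseyNum k r (path k ℓ m) M →
    IsRamseyNum k ((2 * r ∸ 2) / 3) (path k ℓ m) N →
    r * N ≤ (k * k) * M)
    ×
    (Σ ℕ λ D → Σ ℕ λ C → Σ ℕ λ r₀ → Σ ℕ λ n₀ → 1 ≤ D ×
    ((r ℓ m : ℕ) → r₀ ≤ r → 1 ≤ ℓ → 2 * ℓ ≤ k → 1 ≤ m → n₀ ≤ pathV k ℓ m →
    Σ ℕ λ M → IsSizeRamseyNum k r (path k ℓ m) M ×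
    (r * r * pathV k ℓ m ≤ D * M) ×
    (M ≤ C * (r * r * ⌈log₂ r ⌉) * pathV k ℓ m)))
theorem1p7 k 2≤k =
    (λ r ℓ m 2≤r 1≤ℓ 2ℓ≤k 1≤m n-large M N size ramsey →
      ramsey-vs-size r 2≤r 1≤ℓ 2ℓ≤k 1≤m (long-path (12 * (r * r)) 1≤ℓ 2ℓ≤k 1≤m n-large) size ramsey)
  -- The threshold 2 for `r` makes the logarithm positive. A path with `m` edges has at most `k * m`
  -- vertices, so `7 * k` vertices force at least seven edges.
  , 5 * (k * k) , 416 , 2 , 7 * k , *-mono-≤ {1} {5} (s≤s z≤n) (*-mono-≤ 1≤k 1≤k)
  , λ r ℓ m 2≤r 1≤ℓ 2ℓ≤k 1≤m n-large → size-bounds 1≤ℓ 2ℓ≤k 1≤m 2≤r n-large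
  where
  1≤k : 1 ≤ k
  1≤k = ≤-trans (s≤s z≤n) 2≤k
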